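{- Consider the $(a:b)$ minimum-degree-$k$ Maker-Breaker game on $K_n$, and assume that Maker plays according to the Min-Deg-Strategy. (i) For every $\varepsilon>0$ and $k\in\mathbb N$ there is an $n_0(\varepsilon)\in\mathbb N$ such that for every $n\ge n_0(\varepsilon)$, Maker can build a spanning subgraph of $K_n$ with minimum degree at least $k=o(\ln n)$ if $a=o\left(\sqrt{\frac{n}{\ln n}}\right)$ and $b\le(1-\varepsilon)\frac{an}{a+\ln n}$. (ii) For every $\varepsilon>0$ and $k\in\mathbb N$ there is an $n_0(\varepsilon)\in\mathbb N$ such that for every $n\ge n_0(\varepsilon)$, Maker can build a spanning subgraph of $K_n$ with minimum degree at least $k$ if $a=\Omega\left(\sqrt{\frac{n}{\ln n}}\right)$, $k=o(a)$ and $b\le(1-\varepsilon)n$.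
   Context: The $(a:b)$ minimum-degree-$k$ Maker-Breaker game on $K_n$ ($n,a,b\in\mathbb N$, where $k=k(n)$ may depend on $n$): the board is the edge set of the complete graph $K_n$ on $n$ vertices. Breaker starts; in each round Breaker claims $b$ previously unclaimed edges and then Maker claims $a$ previously unclaimed edges. Maker wins if his edges contain a spanning subgraph of $K_n$ with minimum degree at least $k$; otherwise Breaker wins. At any moment of the game, for a vertex $v$, $d_M(v)$ and $d_B(v)$ denote the degree of $v$ in the graph formed by the edges claimed so far by Maker and by Breaker, respectively. The danger of $v$ is $\mathcal D(v)=d_B(v)-\frac{2b}{a}d_M(v)$. Min-Deg-Strategy: for $i\ge1$, Maker's $i$th move consists of $a$ steps. For every $1\le j\le a$, in the $j$th step of his $i$th move Maker chooses a vertex $v_i^{(j)}$ whose danger is maximal and claims an arbitrary not already taken edge incident with $v_i^{(j)}$.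
   Formalization: Part (ii) is proved with the added hypothesis k = o(n), which follows from k = o(a) when a = O(n); without it the claim fails, e.g. for a = n², k = n, since K_n has no subgraph of minimum degree n. -}

module Defs where

open import Data.Fin as Fin using (Fin)
open import Data.Integer using (+_)
open import Data.List using (List; []; _∷_; length; filter; foldr; applyUpTo)
open import Data.List.Membership.Propositional using (_∈_; _∉_)
open import Data.List.Relation.Binary.Sublist.Propositional using (_⊆_)
open import Data.Nat as ℕ using (ℕ; zero; suc; NonZero)
open import Data.Product using (∃-syntax; _×_)
open import Data.Rational using (ℚ; 0ℚ; 1ℚ; _+_; _*_; _-_; _≤_; _<_; _/_)
open import Data.Sum using (_⊎_)
open import Relation.Binary.PropositionalEquality using (_≡_)
open import Relation.Nullary using (¬_; Dec)
open import Relation.Nullary.Decidable using (_⊎-dec_)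

------------------------------------------------------------------------
-- The natural logarithm

fromℕ : ℕ → ℚ
fromℕ n = + n / 1

∑[_] : ℕ → (ℕ → ℚ) → ℚ
∑[ l ] f = foldr _+_ 0ℚ (applyUpTo f l)

-- ln n is the integral of 1/x over [1,n].  These are its Riemann sums with
-- mesh 1/(1+m), heights taken at the right (lower sum) or left (upper sum)
-- ends: the rectangle over [1 + i/(1+m) , 1 + (i+1)/(1+m)] has area
-- 1/(1+m+i+1), respectively 1/(1+m+i).  For n ≥ 1 the two sums differ by
-- (1 - 1/n)/(1+m), so they determine ln n as a real number.
lnLower lnUpper : ℕ → ℕ → ℚ
lnLower n m = ∑[ (n ℕ.∸ 1) ℕ.* suc m ] λ i → + 1 / suc (suc m ℕ.+ i)
lnUpper n m = ∑[ (n ℕ.∸ 1) ℕ.* suc m ] λ i → + 1 / (suc m ℕ.+ i)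

infix 4 _·ln_≤ᵣ_ _≤ᵣ_·ln_

-- The inequalities p · ln n ≤ q and q ≤ p · ln n between real numbers,
-- for rational p ≥ 0 and q, and n ≥ 1.
_·ln_≤ᵣ_ : ℚ → ℕ → ℚ → Set
p ·ln n ≤ᵣ q = ∀ m → p * lnLower n m ≤ q

_≤ᵣ_·ln_ : ℚ → ℚ → ℕ → Set
q ≤ᵣ p ·ln n = ∀ m → q ≤ p * lnUpper n m

------------------------------------------------------------------------
-- Asymptotics

Eventually : (ℕ → Set) → Set
Eventually P = ∃[ N ] (∀ n → N ℕ.≤ n → P n)

infix 4 _∈o_

-- f = o(g)
_∈o_ : (ℕ → ℕ) → (ℕ → ℕ) → Set
f ∈o g = ∀ c → 0ℚ < c → Eventually λ n → fromℕ (f n) ≤ c * fromℕ (g n)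

-- f = o(ln n)
_∈o-ln : (ℕ → ℕ) → Set
f ∈o-ln = ∀ c → 0ℚ < c → Eventually λ n → fromℕ (f n) ≤ᵣ c ·ln n

-- f = o(√(n / ln n)):  f n ≤ c √(n / ln n)  reads  (f n)² · ln n ≤ c² n.
_∈o-√[n/ln] : (ℕ → ℕ) → Set
f ∈o-√[n/ln] = ∀ c → 0ℚ < c → Eventually λ n →
  (fromℕ (f n) * fromℕ (f n)) ·ln n ≤ᵣ (c * c * fromℕ n)

-- f = Ω(√(n / ln n))
_∈Ω-√[n/ln] : (ℕ → ℕ) → Set
f ∈Ω-√[n/ln] = ∃[ c ] (0ℚ < c × Eventually λ n →
  (c * c * fromℕ n) ≤ᵣ (fromℕ (f n) * fromℕ (f n)) ·ln n)

-- b ≤ (1 - ε) · a n / (a + ln n), multiplied by a + ln n.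
BiasBound : ℚ → ℕ → ℕ → ℕ → Set
BiasBound ε n a b =
  fromℕ b ·ln n ≤ᵣ ((1ℚ - ε) * (fromℕ a * fromℕ n) - fromℕ b * fromℕ a)

------------------------------------------------------------------------
-- Edges of the complete graph on Fin n

record Edge (n : ℕ) : Set where
  constructor edge
  field
    lo hi  : Fin n
    .lo<hi : lo Fin.< hi

open Edge public

Incident : ∀ {n} → Fin n → Edge n → Set
Incident v e = v ≡ lo e ⊎ v ≡ hi e

incident? : ∀ {n} (v : Fin n) (e : Edge n) → Dec (Incident v e)
incident? v e = (v Fin.≟ lo e) ⊎-dec (v Fin.≟ hi e)

-- Graphs are duplicate-free edge lists.
degree : ∀ {n} → Fin n → List (Edge n) → ℕ
degree v es = length (filter (incident? v) es)

MinDegree≥ : ∀ {n} → ℕ → List (Edge n) → Set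
MinDegree≥ {n} k es = ∀ (v : Fin n) → k ℕ.≤ degree v es

------------------------------------------------------------------------
-- The game

-- In a play only free edges are claimed, so the two lists stay disjoint and
-- duplicate-free.
record Position (n : ℕ) : Set where
  constructor position
  field
    maker breaker : List (Edge n)

open Position public

start : ∀ {n} → Position n
start = position [] []

Free : ∀ {n} → Position n → Edge n → Set
Free s e = e ∉ maker s × e ∉ breaker s

Exhausted : ∀ {n} → Position n → Set
Exhausted s = ∀ e → ¬ Free s e

MakerWins : ∀ {n} → ℕ → Position n → Set
MakerWins k s = ∃[ H ] (H ⊆ maker s × MinDegree≥ k H)

danger : ∀ {n} (a b : ℕ) .{{_ : NonZero a}} → Position n → Fin n → ℚ
danger a b s v =
  fromℕ (degree v (breaker s)) - (+ (2 ℕ.* b) / a) * fromℕ (degree v (maker s))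

Open : ∀ {n} → Position n → Fin n → Set
Open s v = ∃[ e ] (Free s e × Incident v e)

-- The strategy prescribes claiming an edge at the chosen vertex, so the
-- maximum of the danger is over the vertices that still have a free edge.
MaxDanger : ∀ {n} (a b : ℕ) .{{_ : NonZero a}} → Position n → Fin n → Set
MaxDanger a b s v = Open s v × (∀ w → Open s w → danger a b s w ≤ danger a b s v)

data BreakerStep {n} (s : Position n) : Position n → Set where
  claim : ∀ e → Free s e → BreakerStep s (position (maker s) (e ∷ breaker s))

data MinDegStep {n} (a b : ℕ) .{{_ : NonZero a}} (s : Position n) :
                Position n → Set where
  claim : ∀ v e → MaxDanger a b s v → Free s e → Incident v e →
          MinDegStep a b s (position (e ∷ maker s) (breaker s))

-- A move of j steps, cut short only when no free edge is left.
data Move {n} (Step : Position n → Position n → Set) :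
          ℕ → Position n → Position n → Set where
  done      : ∀ {s} → Move Step zero s s
  exhausted : ∀ {j s} → Exhausted s → Move Step j s s
  step      : ∀ {j s t u} → Step s t → Move Step j t u → Move Step (suc j) s u

-- The positions after some number of full rounds in which Breaker (moving
-- first) plays arbitrarily and Maker follows the Min-Deg-Strategy, with
-- arbitrary choices among the vertices and edges it allows.
data MinDegPlay {n} (a b : ℕ) .{{_ : NonZero a}} : Position n → Set where
  begin : MinDegPlay a b start
  round : ∀ {s t u} → MinDegPlay a b s →
          Move BreakerStep b s t → Move (MinDegStep a b) a t u →
          MinDegPlay a b u

-- On K_n, every play of the (a : b) game in which Maker follows the
-- Min-Deg-Strategy ends with a win for Maker.
MinDegStrategyWins : (n a b k : ℕ) .{{_ : NonZero a}} → Set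
MinDegStrategyWins n a b k =
  ∀ (s : Position n) → MinDegPlay a b s → Exhausted s → MakerWins k s

{-# OPTIONS --safe #-}

-- Between rounds, every set J of j open vertices has average danger at most
-- (2b/a)(H n − H j), where H is the harmonic number.  Indeed a Breaker edge
-- adds at most 2 to the total danger of J, so Breaker's move adds at most 2b.
-- A Maker edge at a vertex v of J takes back 2b/a; if v is not in J, then by
-- maximality of the danger of v the average over J is at most the one over
-- J ∪ {v}, and the bound for the larger set applies.  So an open vertex has
-- danger at most b + (2b/a)(ln n + O(1)) after Breaker's move, while a vertex
-- with fewer than k Maker edges would end with danger at least
-- n − k − (2b/a) k.  This gives (ii).
--
-- For (i) the factor 2 is removed for sets of at most m = n / q vertices, q a
-- large constant: a Breaker edge adds 2 only if it lies inside J, and the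
-- number e(J) of such edges satisfies e(J ∪ {v}) ≤ e(J) + j, so carrying e(J)
-- in the bound costs 1 per step of the induction on j, hence at most m = n / q
-- altogether.  The sets with m < j ≤ n contribute
-- (2b/a)(H n − H m) = O(b/a) = o(n).
module Submission where

open import Defs hiding (begin)
open import Data.Fin as Fin using (Fin)
open import Data.Fin.Properties as Fin using (injective⇒≤)
open import Data.Empty using (⊥-elim; ⊥-elim-irr)
open import Data.List using (List; []; _∷_; length; filter; map; lookup; _++_)
open import Data.List.Membership.DecPropositional as DecMembership using ()
open import Data.List.Membership.Propositional using (_∈_; _∉_)
open import Data.List.Membership.Propositional.Properties using (∈-map⁺; ∈-filter⁺; ∈-++⁺ˡ; ∈-++⁺ʳ; ∈-lookup)
open import Data.List.Membership.Setoid.Properties using (index-injective)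
open import Data.List.Properties using (length-map; length-++; filter-++; filter-accept; filter-reject)
open import Data.List.Relation.Binary.Sublist.Propositional using (⊆-refl)
open import Data.List.Relation.Unary.All as All using (All; []; _∷_)
open import Data.List.Relation.Unary.All.Properties using (¬Any⇒All¬)
open import Data.List.Relation.Unary.AllPairs using ([]; _∷_)
open import Data.List.Relation.Unary.Any as Any using (here; there)
open import Data.List.Relation.Unary.Unique.Propositional using (Unique)
open import Data.Nat as ℕ using (ℕ; zero; suc; NonZero; z≤n; s≤s)
import Data.Nat.DivMod as ℕ
open import Data.Nat.ListAction using (sum)
import Data.Nat.Properties as ℕ
import Data.Nat.Tactic.RingSolver as ℕ
open import Data.Product using (_,_; _×_; proj₁; proj₂; ∃-syntax)
open import Data.Sum using (inj₁; inj₂)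
open import Function using (id)
open import Level using (0ℓ)
open import Relation.Binary using (tri<; tri≈; tri>; DecidableEquality)
open import Relation.Binary.PropositionalEquality
open import Relation.Nullary using (¬_; Dec; yes; no; contradiction)
open import Relation.Nullary.Decidable using (map′; _×-dec_; dec⇒maybe)
open import Tactic.RingSolver using (solve-∀)
import Tactic.RingSolver.Core.AlmostCommutativeRing as ACR

private variable
  A : Set
  n : ℕ

-- Incidence counts in finite graphs.

module Incidence where
  open import Data.Nat using (_+_; _*_; _∸_; _≤_)

  lookup-injective : {xs : List A} → Unique xs → ∀ {i j} → lookup xs i ≡ lookup xs j → i ≡ j
  lookup-injective (x∉ ∷ u) {Fin.zero}  {Fin.zero}  eq = refl
  lookup-injective (x∉ ∷ u) {Fin.zero}  {Fin.suc j} eq = contradiction eq (All.lookup x∉ (∈-lookup j))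
  lookup-injective (x∉ ∷ u) {Fin.suc i} {Fin.zero}  eq = contradiction (sym eq) (All.lookup x∉ (∈-lookup i))
  lookup-injective (x∉ ∷ u) {Fin.suc i} {Fin.suc j} eq = cong Fin.suc (lookup-injective u eq)

  unique-length≤ : {J : List (Fin n)} → Unique J → length J ≤ n
  unique-length≤ u = injective⇒≤ (lookup-injective u)

  covering-length≥ : (xs : List (Fin n)) → (∀ i → i ∈ xs) → n ≤ length xs
  covering-length≥ xs c = injective⇒≤ {f = λ i → Any.index (c i)}
    λ {i} {j} → index-injective (setoid _) (c i) (c j)

  Σ[_] : List A → (A → ℕ) → ℕ
  Σ[ xs ] f = sum (map f xs)

  Σ-mono : {f g : A → ℕ} → (∀ x → f x ≤ g x) → ∀ xs → Σ[ xs ] f ≤ Σ[ xs ] g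
  Σ-mono f≤g []       = z≤n
  Σ-mono f≤g (x ∷ xs) = ℕ.+-mono-≤ (f≤g x) (Σ-mono f≤g xs)

  Σ-zero : {f : A → ℕ} → (∀ x → f x ≡ 0) → ∀ xs → Σ[ xs ] f ≡ 0
  Σ-zero f≡0 []       = refl
  Σ-zero f≡0 (x ∷ xs) = cong₂ _+_ (f≡0 x) (Σ-zero f≡0 xs)

  Σ-+ : (f g : A → ℕ) → ∀ xs → Σ[ xs ] (λ x → f x + g x) ≡ Σ[ xs ] f + Σ[ xs ] g
  Σ-+ f g []       = refl
  Σ-+ f g (x ∷ xs) = trans (cong (f x + g x +_) (Σ-+ f g xs)) (swap (f x) (g x) _ _)
    where
    swap : ∀ p q r s → p + q + (r + s) ≡ p + r + (q + s)
    swap = solve-∀ ℕ.ring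

  -- Two contributing entries would coincide, which a duplicate-free list forbids. It is applied to
  -- the occurrences of one end of an edge and to the edges with two given ends.
  Σ-at-most-one : {f : A → ℕ} → (∀ x → f x ≤ 1) →
                  (∀ {x y} → 1 ≤ f x → 1 ≤ f y → x ≡ y) →
                  ∀ {xs} → Unique xs → Σ[ xs ] f ≤ 1
  Σ-at-most-one f≤1 inj [] = z≤n
  Σ-at-most-one {f = f} f≤1 inj {x ∷ xs} (x∉ ∷ u) with 1 ℕ.≤? f x
  ... | no  fx≱1 rewrite ℕ.n<1⇒n≡0 (ℕ.≰⇒> fx≱1) = Σ-at-most-one f≤1 inj u
  ... | yes fx≥1 = subst (λ k → f x + k ≤ 1) (sym (rest x∉))
                     (subst (_≤ 1) (sym (ℕ.+-identityʳ (f x))) (f≤1 x))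
    where
    rest : ∀ {ys} → All (x ≢_) ys → Σ[ ys ] f ≡ 0
    rest []                    = refl
    rest {y ∷ ys} (x≢y ∷ x∉ys) =
      cong₂ _+_ (ℕ.n<1⇒n≡0 (ℕ.≰⇒> λ fy≥1 → x≢y (inj fx≥1 fy≥1))) (rest x∉ys)

  edge-≡ : {e f : Edge n} → lo e ≡ lo f → hi e ≡ hi f → e ≡ f
  edge-≡ refl refl = refl

  infix 4 _≟ₑ_
  _≟ₑ_ : DecidableEquality (Edge n)
  e ≟ₑ f = map′ (λ (p , q) → edge-≡ p q) (λ p → cong lo p , cong hi p)
                ((lo e Fin.≟ lo f) ×-dec (hi e Fin.≟ hi f))

  edge-determined : {v w : Fin n} {e f : Edge n} → v ≢ w →
    Incident v e → Incident w e → Incident v f → Incident w f → e ≡ f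
  edge-determined v≢w (inj₁ p) (inj₁ q) _ _ = contradiction (trans p (sym q)) v≢w
  edge-determined v≢w (inj₂ p) (inj₂ q) _ _ = contradiction (trans p (sym q)) v≢w
  edge-determined v≢w _ _ (inj₁ p) (inj₁ q) = contradiction (trans p (sym q)) v≢w
  edge-determined v≢w _ _ (inj₂ p) (inj₂ q) = contradiction (trans p (sym q)) v≢w
  edge-determined v≢w (inj₁ p) (inj₂ q) (inj₁ r) (inj₂ s) =
    edge-≡ (trans (sym p) r) (trans (sym q) s)
  edge-determined v≢w (inj₂ p) (inj₁ q) (inj₂ r) (inj₁ s) =
    edge-≡ (trans (sym q) s) (trans (sym p) r)
  -- The two edges would run in opposite orders. The order proofs are irrelevant fields, hence
  -- `⊥-elim-irr`.
  edge-determined {e = edge _ _ l} {edge _ _ l′} v≢w (inj₁ refl) (inj₂ refl) (inj₂ refl) (inj₁ refl) =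
    ⊥-elim-irr (ℕ.<-asym l l′)
  edge-determined {e = edge _ _ l} {edge _ _ l′} v≢w (inj₂ refl) (inj₁ refl) (inj₁ refl) (inj₂ refl) =
    ⊥-elim-irr (ℕ.<-asym l l′)

  inc : Fin n → Edge n → ℕ
  inc v e with incident? v e
  ... | yes _ = 1
  ... | no  _ = 0

  inc≤1 : (v : Fin n) (e : Edge n) → inc v e ≤ 1
  inc≤1 v e with incident? v e
  ... | yes _ = ℕ.≤-refl
  ... | no  _ = z≤n

  incident⇒inc : {v : Fin n} {e : Edge n} → Incident v e → inc v e ≡ 1
  incident⇒inc {v = v} {e} i with incident? v e
  ... | yes _  = refl
  ... | no  ¬i = contradiction i ¬i

  inc⇒incident : {v : Fin n} {e : Edge n} → 1 ≤ inc v e → Incident v e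
  inc⇒incident {v = v} {e} p with incident? v e
  ... | yes i = i
  inc⇒incident () | no  _

  degree-∷ : (v : Fin n) (e : Edge n) (es : List (Edge n)) →
             degree v (e ∷ es) ≡ inc v e + degree v es
  degree-∷ v e es with incident? v e
  ... | yes i = cong length (filter-accept (incident? v) i)
  ... | no ¬i = cong length (filter-reject (incident? v) ¬i)

  volume : List (Fin n) → List (Edge n) → ℕ
  volume J es = Σ[ J ] λ v → degree v es

  hits : List (Fin n) → Edge n → ℕ
  hits J e = Σ[ J ] λ v → inc v e

  volume-∷ : (J : List (Fin n)) (e : Edge n) (es : List (Edge n)) →
             volume J (e ∷ es) ≡ hits J e + volume J es
  volume-∷ []      e es = refl
  volume-∷ (v ∷ J) e es =
    trans (cong₂ _+_ (degree-∷ v e es) (volume-∷ J e es))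
          (swap (inc v e) (degree v es) (hits J e) (volume J es))
    where
    swap : ∀ p q r s → p + q + (r + s) ≡ p + r + (q + s)
    swap = solve-∀ ℕ.ring

  hits≥1 : {v : Fin n} {J : List (Fin n)} {e : Edge n} → v ∈ J → Incident v e → 1 ≤ hits J e
  hits≥1 {e = e} (here refl) i rewrite incident⇒inc {e = e} i = s≤s z≤n
  hits≥1 {J = w ∷ _} {e} (there v∈J) i = ℕ.≤-trans (hits≥1 v∈J i) (ℕ.m≤n+m _ (inc w e))

  -- Incidence with `e` is dominated by the sum of the indicators of its two ends, and each end
  -- occurs at most once in `J`.
  hits≤2 : {J : List (Fin n)} (e : Edge n) → Unique J → hits J e ≤ 2
  hits≤2 {J = J} e u = begin
    hits J e                                       ≤⟨ Σ-mono split J ⟩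
    Σ[ J ] (λ v → at (lo e) v + at (hi e) v)       ≡⟨ Σ-+ (at (lo e)) (at (hi e)) J ⟩
    Σ[ J ] (at (lo e)) + Σ[ J ] (at (hi e))        ≤⟨ ℕ.+-mono-≤ (once (lo e)) (once (hi e)) ⟩
    2                                              ∎
    where
    open ℕ.≤-Reasoning
    at : Fin _ → Fin _ → ℕ
    at x v with v Fin.≟ x
    ... | yes _ = 1
    ... | no  _ = 0
    at≤1 : ∀ x v → at x v ≤ 1
    at≤1 x v with v Fin.≟ x
    ... | yes _ = ℕ.≤-refl
    ... | no  _ = z≤n
    at-≡ : ∀ {x} v → 1 ≤ at x v → v ≡ x
    at-≡ {x} v p with v Fin.≟ x
    ... | yes q = q
    at-≡ {x} v () | no  _
    at-refl : ∀ {v x} → v ≡ x → at x v ≡ 1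
    at-refl {v} {x} p with v Fin.≟ x
    ... | yes _ = refl
    ... | no ¬p = contradiction p ¬p
    once : ∀ x → Σ[ J ] (at x) ≤ 1
    once x = Σ-at-most-one (at≤1 x) (λ p q → trans (at-≡ _ p) (sym (at-≡ _ q))) u
    split : ∀ v → inc v e ≤ at (lo e) v + at (hi e) v
    split v with incident? v e
    ... | no  _        = z≤n
    ... | yes (inj₁ p) rewrite at-refl p = s≤s z≤n
    ... | yes (inj₂ p) rewrite at-refl p = ℕ.m≤n+m 1 (at (lo e) v)

  -- An edge meets a duplicate-free J in 0, 1 or 2 vertices, so hits J e ∸ 1
  -- is 1 exactly for the edges with both ends in J.
  inner : List (Fin n) → List (Edge n) → ℕ
  inner J es = Σ[ es ] λ e → hits J e ∸ 1

  -- No edge has both ends at one vertex. This removes the inner-edge term when the bound is read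
  -- off at a single vertex.
  inner-singleton : (v : Fin n) (es : List (Edge n)) → inner (v ∷ []) es ≡ 0
  inner-singleton v = Σ-zero λ e → ℕ.m≤n⇒m∸n≡0
    (subst (_≤ 1) (sym (ℕ.+-identityʳ (inc v e))) (inc≤1 v e))

  -- Every new inner edge joins `v` to a vertex of `J`, and there is at most one edge for each such
  -- pair.
  inner-grow : {v : Fin n} {J : List (Fin n)} {es : List (Edge n)} →
               v ∉ J → Unique es → inner (v ∷ J) es ≤ inner J es + length J
  inner-grow {v = v} {J} {es} v∉J u = begin
    inner (v ∷ J) es                                           ≤⟨ Σ-mono pointwise es ⟩
    Σ[ es ] (λ e → hits J e ∸ 1 + inc v e * hits J e)          ≡⟨ Σ-+ _ _ es ⟩
    inner J es + Σ[ es ] (λ e → inc v e * hits J e)            ≤⟨ ℕ.+-monoʳ-≤ (inner J es) (joint J v∉J) ⟩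
    inner J es + length J                                      ∎
    where
    open ℕ.≤-Reasoning
    -- An edge away from `v` contributes as before; for an edge at `v` the product alone covers the
    -- left side.
    pointwise : ∀ e → inc v e + hits J e ∸ 1 ≤ hits J e ∸ 1 + inc v e * hits J e
    pointwise e with incident? v e
    ... | no  _ = ℕ.m≤m+n _ _
    ... | yes _ = ℕ.≤-trans (ℕ.≤-reflexive (sym (ℕ.+-identityʳ (hits J e)))) (ℕ.m≤n+m _ (hits J e ∸ 1))
    joint : ∀ K → v ∉ K → Σ[ es ] (λ e → inc v e * hits K e) ≤ length K
    joint []      _   = ℕ.≤-reflexive (Σ-zero (λ e → ℕ.*-zeroʳ (inc v e)) es)
    joint (w ∷ K) v∉K = begin
      Σ[ es ] (λ e → inc v e * (inc w e + hits K e))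
        ≤⟨ Σ-mono (λ e → ℕ.≤-reflexive (ℕ.*-distribˡ-+ (inc v e) (inc w e) (hits K e))) es ⟩
      Σ[ es ] (λ e → inc v e * inc w e + inc v e * hits K e)   ≡⟨ Σ-+ _ _ es ⟩
      Σ[ es ] (λ e → inc v e * inc w e) + Σ[ es ] (λ e → inc v e * hits K e)
        ≤⟨ ℕ.+-mono-≤ pair (joint K (λ v∈K → v∉K (there v∈K))) ⟩
      suc (length K)                                           ∎
      where
      both : ∀ {e} → 1 ≤ inc v e * inc w e → Incident v e × Incident w e
      both {e} p with incident? v e | incident? w e
      ... | yes i | yes j = i , j
      both {e} () | yes _ | no _
      both {e} () | no _ | _
      pair : Σ[ es ] (λ e → inc v e * inc w e) ≤ 1
      pair = Σ-at-most-one (λ e → ℕ.*-mono-≤ (inc≤1 v e) (inc≤1 w e))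
        (λ p q → edge-determined (λ v≡w → v∉K (here v≡w))
                   (proj₁ (both p)) (proj₂ (both p)) (proj₁ (both q)) (proj₂ (both q))) u

  -- Every other vertex is joined to `v` by a claimed edge, so `v` and the far ends of the claimed
  -- edges at `v` cover all vertices. The `suc` counts `v` itself.
  exhausted-degree : {s : Position n} → Exhausted s → ∀ v →
                     n ≤ suc (degree v (maker s) + degree v (breaker s))
  exhausted-degree {n} {s} ex v = subst (n ≤_) (cong suc size) (covering-length≥ (v ∷ ends) covered)
    where
    open DecMembership _≟ₑ_ using (_∈?_)
    taken : List (Edge n)
    taken = maker s ++ breaker s
    far : Edge n → Fin n
    far e with v Fin.≟ lo e
    ... | yes _ = hi e
    ... | no  _ = lo e
    ends : List (Fin n)
    ends = map far (filter (incident? v) taken)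
    size : length ends ≡ degree v (maker s) + degree v (breaker s)
    size = trans (length-map far (filter (incident? v) taken))
      (trans (cong length (filter-++ (incident? v) (maker s) (breaker s)))
             (length-++ (filter (incident? v) (maker s))))
    claimed : ∀ e → e ∈ taken
    claimed e with e ∈? maker s | e ∈? breaker s
    ... | yes p | _     = ∈-++⁺ˡ p
    ... | no  _ | yes q = ∈-++⁺ʳ (maker s) q
    ... | no  p | no  q = ⊥-elim (ex e (p , q))
    end : ∀ e → Incident v e → far e ∈ ends
    end e i = ∈-map⁺ far (∈-filter⁺ (incident? v) (claimed e) i)
    covered : ∀ w → w ∈ v ∷ ends
    covered w with Fin.<-cmp v w
    ... | tri≈ _ v≡w _ = here (sym v≡w)
    ... | tri< v<w _ _ = there (subst (_∈ ends) far≡ (end (edge v w v<w) (inj₁ refl)))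
      where
      far≡ : far (edge v w v<w) ≡ w
      far≡ with v Fin.≟ v
      ... | yes _  = refl
      ... | no v≢v = contradiction refl v≢v
    ... | tri> _ v≢w w<v = there (subst (_∈ ends) far≡ (end (edge w v w<v) (inj₂ refl)))
      where
      far≡ : far (edge w v w<v) ≡ w
      far≡ with v Fin.≟ w
      ... | yes v≡w = contradiction v≡w v≢w
      ... | no _    = refl

open Incidence

-- Rational arithmetic.

open import Data.Integer as ℤ using (+_)
import Data.Integer.Properties as ℤ
open import Data.Rational hiding (NonZero)
import Data.Rational as ℚ
open import Data.Rational.Properties
open import Data.Rational.Unnormalised as ℚᵘ using (mkℚᵘ; *≡*; *≤*)
import Data.Rational.Unnormalised.Properties as ℚᵘ

ℚ-ring : ACR.AlmostCommutativeRing 0ℓ 0ℓ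
ℚ-ring = ACR.fromCommutativeRing +-*-commutativeRing λ x → dec⇒maybe (0ℚ ≟ x)

toℚᵘ-fromℕ : ∀ m → toℚᵘ (fromℕ m) ℚᵘ.≃ mkℚᵘ (+ m) 0
toℚᵘ-fromℕ m = toℚᵘ-fromℚᵘ (mkℚᵘ (+ m) 0)

fromℕ-+ : ∀ m n → fromℕ (m ℕ.+ n) ≡ fromℕ m + fromℕ n
fromℕ-+ m n = toℚᵘ-injective (begin
  toℚᵘ (fromℕ (m ℕ.+ n))                  ≈⟨ toℚᵘ-fromℕ (m ℕ.+ n) ⟩
  mkℚᵘ (+ (m ℕ.+ n)) 0                    ≈⟨ *≡* (cong (ℤ._* (+ 1)) (cong₂ ℤ._+_ (sym (ℤ.*-identityʳ (+ m))) (sym (ℤ.*-identityʳ (+ n))))) ⟩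
  mkℚᵘ (+ m) 0 ℚᵘ.+ mkℚᵘ (+ n) 0          ≈⟨ ℚᵘ.+-cong (toℚᵘ-fromℕ m) (toℚᵘ-fromℕ n) ⟨
  toℚᵘ (fromℕ m) ℚᵘ.+ toℚᵘ (fromℕ n)      ≈⟨ toℚᵘ-homo-+ (fromℕ m) (fromℕ n) ⟨
  toℚᵘ (fromℕ m + fromℕ n)                ∎)
  where open ℚᵘ.≃-Reasoning

fromℕ-* : ∀ m n → fromℕ (m ℕ.* n) ≡ fromℕ m * fromℕ n
fromℕ-* zero    n = sym (*-zeroˡ (fromℕ n))
fromℕ-* (suc m) n =
  trans (fromℕ-+ n (m ℕ.* n))
  (trans (cong (λ x → fromℕ n + x) (fromℕ-* m n))
  (trans (factor (fromℕ m) (fromℕ n))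
         (cong (_* fromℕ n) (sym (fromℕ-+ 1 m)))))
  where
  factor : ∀ x y → y + x * y ≡ (1ℚ + x) * y
  factor = solve-∀ ℚ-ring

fromℕ-suc : ∀ m → fromℕ (suc m) ≡ 1ℚ + fromℕ m
fromℕ-suc = fromℕ-+ 1

0≤fromℕ : ∀ m → 0ℚ ≤ fromℕ m
0≤fromℕ m = nonNegative⁻¹ (fromℕ m) {{normalize-nonNeg m 1}}

0≤1 : 0ℚ ≤ 1ℚ
0≤1 = 0≤fromℕ 1

infixl 6 _⊞_
infixl 7 _⊠_

_⊞_ : ∀ {x y} → 0ℚ ≤ x → 0ℚ ≤ y → 0ℚ ≤ x + y
_⊞_ = +-mono-≤

_⊠_ : ∀ {x y} → 0ℚ ≤ x → 0ℚ ≤ y → 0ℚ ≤ x * y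
_⊠_ {x} {y} p q = nonNegative⁻¹ (x * y) {{nonNeg*nonNeg⇒nonNeg x {{nonNegative p}} y {{nonNegative q}}}}

gap : ∀ {x y} → x ≤ y → 0ℚ ≤ y - x
gap {x} {y} x≤y = subst (_≤ y - x) (+-inverseʳ x) (+-monoˡ-≤ (- x) x≤y)

-- Linear arithmetic with an explicit certificate: d is the non-negative
-- combination of hypotheses that witnesses x ≤ y.
by-gap : ∀ {x y} d → y - x ≡ d → 0ℚ ≤ d → x ≤ y
by-gap {x} {y} d eq 0≤d = subst₂ _≤_ (+-identityˡ x) (restore x y)
  (+-monoˡ-≤ x (subst (0ℚ ≤_) (sym eq) 0≤d))
  where
  restore : ∀ x y → y - x + x ≡ y
  restore = solve-∀ ℚ-ring

fromℕ-mono-≤ : ∀ {m n} → m ℕ.≤ n → fromℕ m ≤ fromℕ n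
fromℕ-mono-≤ {m} m≤n with ℕ.m≤n⇒∃[o]m+o≡n m≤n
... | o , refl = by-gap (fromℕ o)
  (trans (cong (_- fromℕ m) (fromℕ-+ m o)) (drop (fromℕ m) (fromℕ o))) (0≤fromℕ o)
  where
  drop : ∀ x y → x + y - x ≡ y
  drop = solve-∀ ℚ-ring

-- Inequalities between averages get a division-free certificate after multiplication by a positive
-- factor such as a set size.
by-scaled-gap : ∀ {x y} c .{{_ : Positive c}} d → c * (y - x) ≡ d → 0ℚ ≤ d → x ≤ y
by-scaled-gap {x} {y} c d eq 0≤d = by-gap (y - x) refl
  (*-cancelˡ-≤-pos c (subst₂ _≤_ (sym (*-zeroʳ c)) (sym eq) 0≤d))

fromℕ-suc-pos : ∀ m → Positive (fromℕ (suc m))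
fromℕ-suc-pos m = normalize-pos (suc m) 1

/-cancel : ∀ m d .{{_ : NonZero d}} → (+ m / d) * fromℕ d ≡ fromℕ m
/-cancel m d@(suc d′) = toℚᵘ-injective (begin
  toℚᵘ ((+ m / d) * fromℕ d)             ≈⟨ toℚᵘ-homo-* (+ m / d) (fromℕ d) ⟩
  toℚᵘ (+ m / d) ℚᵘ.* toℚᵘ (fromℕ d)     ≈⟨ ℚᵘ.*-cong (toℚᵘ-fromℚᵘ (mkℚᵘ (+ m) d′)) (toℚᵘ-fromℕ d) ⟩
  mkℚᵘ (+ m) d′ ℚᵘ.* mkℚᵘ (+ d) 0        ≈⟨ *≡* (ℤ.*-assoc (+ m) (+ d) (+ 1)) ⟩
  mkℚᵘ (+ m) 0                           ≈⟨ toℚᵘ-fromℕ m ⟨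
  toℚᵘ (fromℕ m)                         ∎)
  where open ℚᵘ.≃-Reasoning

resp-≤ : ∀ {x x′ y y′} → x ≡ x′ → y ≡ y′ → x′ ≤ y′ → x ≤ y
resp-≤ refl refl p = p

-- fromℕ sealed, so that the type checker does not normalise fractions.
opaque
  ⟦_⟧ : ℕ → ℚ
  ⟦ m ⟧ = fromℕ m

  ⟦⟧≡fromℕ : ∀ m → ⟦ m ⟧ ≡ fromℕ m
  ⟦⟧≡fromℕ m = refl

  ⟦⟧-+ : ∀ m n → ⟦ m ℕ.+ n ⟧ ≡ ⟦ m ⟧ + ⟦ n ⟧
  ⟦⟧-+ = fromℕ-+

  ⟦⟧-* : ∀ m n → ⟦ m ℕ.* n ⟧ ≡ ⟦ m ⟧ * ⟦ n ⟧
  ⟦⟧-* = fromℕ-*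

  ⟦⟧-suc : ∀ m → ⟦ suc m ⟧ ≡ 1ℚ + ⟦ m ⟧
  ⟦⟧-suc = fromℕ-suc

  ⟦0⟧ : ⟦ 0 ⟧ ≡ 0ℚ
  ⟦0⟧ = refl

  ⟦1⟧ : ⟦ 1 ⟧ ≡ 1ℚ
  ⟦1⟧ = refl

  0≤⟦_⟧ : ∀ m → 0ℚ ≤ ⟦ m ⟧
  0≤⟦_⟧ = 0≤fromℕ

  ⟦⟧-mono-≤ : ∀ {m n} → m ℕ.≤ n → ⟦ m ⟧ ≤ ⟦ n ⟧
  ⟦⟧-mono-≤ = fromℕ-mono-≤

  ⟦suc⟧-pos : ∀ m → Positive ⟦ suc m ⟧
  ⟦suc⟧-pos = fromℕ-suc-pos

  /-cancel-⟦⟧ : ∀ m d .{{_ : NonZero d}} → (+ m / d) * ⟦ d ⟧ ≡ ⟦ m ⟧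
  /-cancel-⟦⟧ = /-cancel

-- Harmonic numbers.

opaque
  H : ℕ → ℚ
  H zero    = 0ℚ
  H (suc j) = H j + + 1 / suc j

  H-zero : H 0 ≡ 0ℚ
  H-zero = refl

  H-suc : ∀ j → H (suc j) ≡ H j + + 1 / suc j
  H-suc j = refl

recip-cancel : ∀ j → ⟦ suc j ⟧ * (+ 1 / suc j) ≡ 1ℚ
recip-cancel j = trans (*-comm ⟦ suc j ⟧ (+ 1 / suc j)) (trans (/-cancel-⟦⟧ 1 (suc j)) ⟦1⟧)

0≤recip : ∀ j → 0ℚ ≤ + 1 / suc j
0≤recip j = nonNegative⁻¹ (+ 1 / suc j) {{normalize-nonNeg 1 (suc j)}}

-- The product form lets the ring solver use the increment of `H` without meeting a fraction.
H-step : ∀ j → ⟦ suc j ⟧ * (H (suc j) - H j) ≡ 1ℚ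
H-step j = trans (cong (λ h → ⟦ suc j ⟧ * (h - H j)) (H-suc j))
  (trans (cong (⟦ suc j ⟧ *_) (drop (H j) (+ 1 / suc j))) (recip-cancel j))
  where
  drop : ∀ x y → x + y - x ≡ y
  drop = solve-∀ ℚ-ring

H-mono : ∀ {i j} → i ℕ.≤ j → H i ≤ H j
H-mono i≤j = go (ℕ.≤⇒≤′ i≤j)
  where
  go : ∀ {i j} → i ℕ.≤′ j → H i ≤ H j
  go ℕ.≤′-refl = ≤-refl
  go (ℕ.≤′-step {n = j} p) = ≤-trans (go p) (resp-≤ (sym (+-identityʳ (H j))) (H-suc j)
    (+-monoʳ-≤ (H j) (0≤recip j)))

-- Invariants of moves and plays.

volume-[] : (J : List (Fin n)) → volume J [] ≡ 0
volume-[] = Σ-zero λ _ → refl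

-- The index counts the steps still owed in the move. A move cut short on an exhausted board may
-- leave some owed, and `stop` then brings the index to zero.
run : ∀ {Step : Position n → Position n → Set} (P : ℕ → Position n → Set) →
      (∀ {t s u} → P (suc t) s → Step s u → P t u) →
      (∀ {t s} → Exhausted s → P t s → P 0 s) →
      ∀ {t s u} → P t s → Move Step t s u → P 0 u
run P next stop p done           = p
run P next stop p (exhausted ex) = stop ex p
run P next stop p (step x m)     = run P next stop (next p x) m

-- Claims only remove free edges, so a set of open vertices was already open before, and the earlier
-- bound applies to it.
open-claim : ∀ {s u : Position n} → (∀ e → Free u e → Free s e) → ∀ {v} → Open u v → Open s v
open-claim free (e , f , i) = e , free e f , i

breaker-open : ∀ {s u : Position n} → BreakerStep s u → ∀ {v} → Open u v → Open s v
breaker-open (claim _ _) = open-claim λ e (p , q) → p , λ e∈ → q (there e∈)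

module Game {n : ℕ} (a b : ℕ) .{{_ : NonZero a}} where

  α β γ : ℚ
  α = ⟦ a ⟧
  β = ⟦ b ⟧
  γ = ⟦ 2 ℕ.* b ⟧

  γ≡2β : γ ≡ β + β
  γ≡2β = trans (cong (λ k → ⟦ b ℕ.+ k ⟧) (ℕ.+-identityʳ b)) (⟦⟧-+ b b)

  maker-open : ∀ {s u : Position n} → MinDegStep a b s u → ∀ {v} → Open u v → Open s v
  maker-open (claim _ _ _ _ _) = open-claim λ e (p , q) → (λ e∈ → p (there e∈)) , q

  dM dB : Position n → Fin n → ℚ
  dM s v = ⟦ degree v (maker s) ⟧
  dB s v = ⟦ degree v (breaker s) ⟧

  -- Multiplying by `a` clears the fraction 2b/a; all later bounds on danger carry this factor.
  danger-scaled : ∀ (s : Position n) v → α * danger a b s v ≡ α * dB s v - γ * dM s v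
  danger-scaled s v = trans
    (cong₂ (λ x y → α * (x - (+ (2 ℕ.* b) / a) * y))
      (sym (⟦⟧≡fromℕ (degree v (breaker s)))) (sym (⟦⟧≡fromℕ (degree v (maker s)))))
    (trans (distribute α (+ (2 ℕ.* b) / a) (dB s v) (dM s v))
           (cong (λ x → α * dB s v - x * dM s v) (/-cancel-⟦⟧ (2 ℕ.* b) a)))
    where
    distribute : ∀ x q y z → x * (y - q * z) ≡ x * y - q * x * z
    distribute = solve-∀ ℚ-ring

  danger-≤ : ∀ (s : Position n) {w v} → danger a b s w ≤ danger a b s v →
    α * dB s w + γ * dM s v ≤ α * dB s v + γ * dM s w
  danger-≤ s {w} {v} p = by-gap _
    (rearrange (α * dB s w) (γ * dM s v) (α * dB s v) (γ * dM s w))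
    (gap (resp-≤ (sym (danger-scaled s w)) (sym (danger-scaled s v))
      (*-monoˡ-≤-nonNeg α {{nonNegative 0≤⟦ a ⟧}} p)))
    where
    rearrange : ∀ p q r s → r + s - (p + q) ≡ (r - q) - (p - s)
    rearrange = solve-∀ ℚ-ring

  volM volB : Position n → List (Fin n) → ℚ
  volM s J = ⟦ volume J (maker s) ⟧
  volB s J = ⟦ volume J (breaker s) ⟧

  volM-∷ : ∀ s v J → volM s (v ∷ J) ≡ dM s v + volM s J
  volM-∷ s v J = ⟦⟧-+ (degree v (maker s)) (volume J (maker s))

  volB-∷ : ∀ s v J → volB s (v ∷ J) ≡ dB s v + volB s J
  volB-∷ s v J = ⟦⟧-+ (degree v (breaker s)) (volume J (breaker s))

  -- The comparisons `danger-≤` are summed over `J`. With denominators cleared and negative terms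
  -- moved across, the average danger over `J` is compared with the danger of `v`.
  volume-danger : ∀ (s : Position n) {v} J → All (λ w → danger a b s w ≤ danger a b s v) J →
    α * volB s J + ⟦ length J ⟧ * (γ * dM s v) ≤ ⟦ length J ⟧ * (α * dB s v) + γ * volM s J
  volume-danger s {v} [] [] = ≤-reflexive
    (trans (cong (λ z → α * z + z * (γ * dM s v)) ⟦0⟧)
    (trans (vanish α γ (γ * dM s v) (α * dB s v))
           (sym (cong (λ z → z * (α * dB s v) + γ * z) ⟦0⟧))))
    where
    vanish : ∀ x y z w → x * 0ℚ + 0ℚ * z ≡ 0ℚ * w + y * 0ℚ
    vanish = solve-∀ ℚ-ring
  volume-danger s {v} (w ∷ J) (p ∷ ps) =
    resp-≤ (cong₂ (λ x y → α * x + y * (γ * dM s v)) (volB-∷ s w J) (⟦⟧-suc (length J)))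
           (cong₂ (λ x y → x * (α * dB s v) + γ * y) (⟦⟧-suc (length J)) (volM-∷ s w J))
      (by-gap _ (split α γ ⟦ length J ⟧ (dB s w) (volB s J) (dM s w) (volM s J) (dB s v) (dM s v))
        (gap (danger-≤ s p) ⊞ gap (volume-danger s J ps)))
    where
    split : ∀ α γ j bw bJ mw mJ bv mv →
      (1ℚ + j) * (α * bv) + γ * (mw + mJ) - (α * (bw + bJ) + (1ℚ + j) * (γ * mv)) ≡
      (α * bv + γ * mw - (α * bw + γ * mv)) + (j * (α * bv) + γ * mJ - (α * bJ + j * (γ * mv)))
    split = solve-∀ ℚ-ring

  -- P τ s: at position s the part τ of the current round is unanswered.  It
  -- grows by a with each edge of Breaker, up to a b, and then shrinks by b with
  -- each edge of Maker.
  module Round (P : ℚ → Position n → Set) (init : P 0ℚ start)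
    (br : ∀ τ {s u} → P τ s → BreakerStep s u → P (τ + α) u)
    (mk : ∀ τ {s u} → 0ℚ ≤ τ → τ ≤ α * β → P (τ + β) s → MinDegStep a b s u → P τ u)
    (ex : ∀ τ τ′ {s} → Exhausted s → 0ℚ ≤ τ′ → P τ s → P τ′ s) where

    breaker-phase : ∀ {s u} → P 0ℚ s → Move BreakerStep b s u → P (α * β) u
    breaker-phase {s} {u} p m = subst (λ τ → P τ u) full
      (run Q (λ {t} {_} {u} q x → subst (λ τ → P τ u) (next t) (br _ q x))
        (λ {t} e q → ex _ _ e (subst (0ℚ ≤_) (sym full) (0≤⟦ a ⟧ ⊠ 0≤⟦ b ⟧)) q)
        (subst (λ τ → P τ s) (nothing-yet α β) p) m)
      where
      -- `t` counts the edges Breaker still has to claim, so `τ` rises from 0 to `α * β`.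
      Q : ℕ → Position n → Set
      Q t s = P ((β - ⟦ t ⟧) * α) s
      nothing-yet : ∀ x y → 0ℚ ≡ (y - y) * x
      nothing-yet = solve-∀ ℚ-ring
      one-more : ∀ t x y → (y - (1ℚ + t)) * x + x ≡ (y - t) * x
      one-more = solve-∀ ℚ-ring
      next : ∀ t → (β - ⟦ suc t ⟧) * α + α ≡ (β - ⟦ t ⟧) * α
      next t = trans (cong (λ k → (β - k) * α + α) (⟦⟧-suc t)) (one-more ⟦ t ⟧ α β)
      all : ∀ x y → (y - 0ℚ) * x ≡ x * y
      all = solve-∀ ℚ-ring
      full : (β - ⟦ 0 ⟧) * α ≡ α * β
      full = trans (cong (λ k → (β - k) * α) ⟦0⟧) (all α β)

    maker-phase : ∀ {s u} → P (α * β) s → Move (MinDegStep a b) a s u → P 0ℚ u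
    maker-phase {s} {u} p m = subst (λ τ → P τ u) none (proj₂
      (run Q (λ {t} {s} (t<a , q) x → ℕ.<⇒≤ t<a ,
               mk _ (0≤⟦ t ⟧ ⊠ 0≤⟦ b ⟧)
                  (*-monoʳ-≤-nonNeg β {{nonNegative 0≤⟦ b ⟧}} (⟦⟧-mono-≤ (ℕ.<⇒≤ t<a)))
                  (subst (λ τ → P τ s) (next t) q) x)
             (λ e (_ , q) → z≤n , ex _ _ e (≤-reflexive (sym none)) q)
             (ℕ.≤-refl , p) m))
      where
      -- Here `t` counts Maker's remaining edges. Carrying `t ≤ a` supplies the hypothesis
      -- `τ ≤ α * β` of `mk`.
      Q : ℕ → Position n → Set
      Q t s = t ℕ.≤ a × P (⟦ t ⟧ * β) s
      one-less : ∀ t y → (1ℚ + t) * y ≡ t * y + y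
      one-less = solve-∀ ℚ-ring
      next : ∀ t → ⟦ suc t ⟧ * β ≡ ⟦ t ⟧ * β + β
      next t = trans (cong (_* β) (⟦⟧-suc t)) (one-less ⟦ t ⟧ β)
      none : ⟦ 0 ⟧ * β ≡ 0ℚ
      none = trans (cong (_* β) ⟦0⟧) (*-zeroˡ β)

    between-rounds : ∀ {s} → MinDegPlay a b s → P 0ℚ s
    between-rounds MinDegPlay.begin   = init
    between-rounds (round play bm mm) = maker-phase (breaker-phase (between-rounds play) bm) mm


  -- `κ` is the charge per Breaker edge, `E` the part of Breaker's contribution that is accounted
  -- for separately, and `ℓ` its growth per member of the set when a vertex joins. Apart from these,
  -- `φ j` bounds `a` times the average danger of `j` vertices. By `φ-step`, going from `j + 1`
  -- vertices to `j` makes room for `κ b / (j + 1)` and `ℓ`.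
  module Budget (κ ℓ : ℚ) (m : ℕ) (E : List (Fin n) → List (Edge n) → ℚ) (φ : ℕ → ℚ)
    (0≤κ : 0ℚ ≤ κ) (κ≤2 : κ ≤ 1ℚ + 1ℚ) (0≤ℓ : 0ℚ ≤ ℓ)
    (0≤E : ∀ J es → 0ℚ ≤ E J es)
    (E-claim : ∀ {J} e es → Unique J → α * ⟦ hits J e ⟧ + E J es ≤ κ * α + E J (e ∷ es))
    (E-grow : ∀ {v J es} → v ∉ J → Unique es → E (v ∷ J) es ≤ E J es + ℓ * ⟦ length J ⟧)
    (0≤φ : ∀ {j} → j ℕ.≤ m → 0ℚ ≤ φ j)
    (φ-step : ∀ j → κ * β + ⟦ suc j ⟧ * (ℓ + φ (suc j)) ≤ ⟦ suc j ⟧ * φ j)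
    where

    Within : ℚ → Position n → List (Fin n) → Set
    Within τ s J = α * volB s J ≤ γ * volM s J + E J (breaker s) + κ * τ + ⟦ length J ⟧ * φ (length J)

    AllWithin : ℚ → Position n → Set
    AllWithin τ s = ∀ {J} → Unique J → All (Open s) J → length J ℕ.≤ m → Within τ s J

    within-start : AllWithin 0ℚ start
    within-start {J} _ _ J≤m = resp-≤
      (cong (α *_) empty) (cong (λ z → γ * z + E J [] + κ * 0ℚ + ⟦ length J ⟧ * φ (length J)) empty)
      (by-gap _ (vanish α γ (E J []) κ ⟦ length J ⟧ (φ (length J)))
        (0≤E J [] ⊞ 0≤⟦ length J ⟧ ⊠ 0≤φ J≤m))
      where
      empty : ⟦ volume J [] ⟧ ≡ 0ℚ
      empty = trans (cong ⟦_⟧ (volume-[] J)) ⟦0⟧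
      vanish : ∀ x y e κ j p → y * 0ℚ + e + κ * 0ℚ + j * p - x * 0ℚ ≡ e + j * p
      vanish = solve-∀ ℚ-ring

    -- Without free edges the only set of open vertices is the empty one.
    within-exhausted : ∀ τ {s} → Exhausted s → 0ℚ ≤ τ → AllWithin τ s
    within-exhausted τ {s} ex 0≤τ {[]} _ _ _ = resp-≤
      (cong (α *_) ⟦0⟧) (cong (λ z → γ * z + E [] (breaker s) + κ * τ + z * φ 0) ⟦0⟧)
      (by-gap _ (vanish α γ (E [] (breaker s)) (κ * τ) (φ 0))
        (0≤E [] (breaker s) ⊞ 0≤κ ⊠ 0≤τ))
      where
      vanish : ∀ x y e t p → y * 0ℚ + e + t + 0ℚ * p - x * 0ℚ ≡ e + t
      vanish = solve-∀ ℚ-ring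
    within-exhausted τ ex 0≤τ {v ∷ J} _ ((e , f , _) ∷ _) _ = contradiction f (ex e)

    within-breaker : ∀ τ {s u} → AllWithin τ s → BreakerStep s u → AllWithin (τ + α) u
    within-breaker τ {s} p x@(claim e _) {J} uJ oJ J≤m = resp-≤
      (cong (α *_) (trans (cong ⟦_⟧ (volume-∷ J e (breaker s))) (⟦⟧-+ (hits J e) (volume J (breaker s)))))
      refl
      (by-gap _ (split α κ ⟦ hits J e ⟧ (volB s J) (γ * volM s J)
                   (E J (breaker s)) (E J (e ∷ breaker s)) τ (⟦ length J ⟧ * φ (length J)))
        (gap (p uJ (All.map (breaker-open x) oJ) J≤m) ⊞ gap (E-claim e (breaker s) uJ)))
      where
      split : ∀ α κ h V U E E′ τ P → U + E′ + κ * (τ + α) + P - α * (h + V) ≡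
              (U + E + κ * τ + P - α * V) + (κ * α + E′ - (α * h + E))
      split = solve-∀ ℚ-ring

    volM-claim : ∀ J e s → ⟦ volume J (e ∷ maker s) ⟧ ≡ ⟦ hits J e ⟧ + volM s J
    volM-claim J e s = trans (cong ⟦_⟧ (volume-∷ J e (maker s))) (⟦⟧-+ (hits J e) (volume J (maker s)))

    -- Maker's edge lowers the scaled danger of `J` by at least `γ = 2β`, while only `κ * β ≤ 2β` of
    -- the unanswered part has to be paid off.
    within-hit : ∀ τ {s v e J} → v ∈ J → Incident v e → Within (τ + β) s J →
      Within τ (position (e ∷ maker s) (breaker s)) J
    within-hit τ {s} {v} {e} {J} v∈J i p = resp-≤ refl
      (cong (λ z → γ * z + E J (breaker s) + κ * τ + P) (volM-claim J e s))
      (by-gap ((γ * volM s J + E J (breaker s) + κ * (τ + β) + P - α * volB s J)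
                + γ * (⟦ hits J e ⟧ - 1ℚ) + (1ℚ + 1ℚ - κ) * β)
        (trans (cong (λ g → g * (⟦ hits J e ⟧ + volM s J) + E J (breaker s) + κ * τ + P - α * volB s J) γ≡2β)
        (trans (split α β κ ⟦ hits J e ⟧ (volM s J) (volB s J) (E J (breaker s)) τ P)
               (cong (λ g → (g * volM s J + E J (breaker s) + κ * (τ + β) + P - α * volB s J)
                              + g * (⟦ hits J e ⟧ - 1ℚ) + (1ℚ + 1ℚ - κ) * β) (sym γ≡2β))))
        (gap p
          ⊞ 0≤⟦ 2 ℕ.* b ⟧ ⊠ gap (subst (_≤ ⟦ hits J e ⟧) ⟦1⟧ (⟦⟧-mono-≤ (hits≥1 v∈J i)))
          ⊞ gap κ≤2 ⊠ 0≤⟦ b ⟧))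
      where
      P : ℚ
      P = ⟦ length J ⟧ * φ (length J)
      split : ∀ α β κ h U V E τ P → (β + β) * (h + U) + E + κ * τ + P - α * V ≡
        ((β + β) * U + E + κ * (τ + β) + P - α * V) + (β + β) * (h - 1ℚ) + (1ℚ + 1ℚ - κ) * β
      split = solve-∀ ℚ-ring

    -- As `v` has maximal danger, `j + 1` times the total danger of `J` is at most `j` times that of
    -- `v ∷ J`. Compared with `J`, the bound for `v ∷ J` contains up to `ℓ * j` more in `E` and
    -- `κ * β` more for the unanswered part; `φ-step` absorbs both.
    within-miss : ∀ τ {s v e J} → 0ℚ ≤ τ → Unique (breaker s) → v ∉ J →
      All (λ w → danger a b s w ≤ danger a b s v) J → Within (τ + β) s (v ∷ J) →
      Within τ (position (e ∷ maker s) (breaker s)) J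
    within-miss τ {s} {v} {e} {J} 0≤τ uB v∉J max p = resp-≤ refl
      (cong (λ z → γ * z + E J (breaker s) + κ * τ + ⟦ j ⟧ * φ j) (volM-claim J e s))
      (by-scaled-gap ⟦ suc j ⟧ {{⟦suc⟧-pos j}} _
        (trans (cong (_* (γ * (⟦ hits J e ⟧ + volM s J) + E J (breaker s) + κ * τ + ⟦ j ⟧ * φ j
                            - α * volB s J)) (⟦⟧-suc j))
           (split α β γ κ ℓ ⟦ j ⟧ ⟦ hits J e ⟧ (volM s J) (volB s J) (dM s v) (dB s v)
             (E J (breaker s)) (E (v ∷ J) (breaker s)) τ (φ j) (φ (suc j))))
        (gap (volume-danger s {v} J max)
          ⊞ 0≤⟦ j ⟧ ⊠ gap grown
          ⊞ 0≤⟦ j ⟧ ⊠ gap (E-grow v∉J uB)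
          ⊞ 0≤⟦ j ⟧ ⊠ gap (subst (λ k → κ * β + k * (ℓ + φ (suc j)) ≤ k * φ j) (⟦⟧-suc j) (φ-step j))
          ⊞ (subst (0ℚ ≤_) (⟦⟧-suc j) 0≤⟦ suc j ⟧ ⊠ 0≤⟦ 2 ℕ.* b ⟧ ⊠ 0≤⟦ hits J e ⟧
             ⊞ 0≤E J (breaker s) ⊞ 0≤κ ⊠ 0≤τ ⊞ 0≤⟦ j ⟧ ⊠ 0≤ℓ)))
      where
      j : ℕ
      j = length J
      grown : α * (dB s v + volB s J) ≤
        γ * (dM s v + volM s J) + E (v ∷ J) (breaker s) + κ * (τ + β) + (1ℚ + ⟦ j ⟧) * φ (suc j)
      grown = resp-≤ (cong (α *_) (sym (volB-∷ s v J)))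
        (cong₂ (λ y z → γ * y + E (v ∷ J) (breaker s) + κ * (τ + β) + z * φ (suc j))
          (sym (volM-∷ s v J)) (sym (⟦⟧-suc j)))
        p
      split : ∀ α β γ κ ℓ j h U V M B E E′ τ φ φ′ →
        (1ℚ + j) * (γ * (h + U) + E + κ * τ + j * φ - α * V) ≡
        (j * (α * B) + γ * U - (α * V + j * (γ * M)))
        + j * (γ * (M + U) + E′ + κ * (τ + β) + (1ℚ + j) * φ′ - α * (B + V))
        + j * (E + ℓ * j - E′)
        + j * ((1ℚ + j) * φ - (κ * β + (1ℚ + j) * (ℓ + φ′)))
        + ((1ℚ + j) * γ * h + E + κ * τ + j * ℓ)
      split = solve-∀ ℚ-ring

    -- If `J` has `m` vertices and misses `v`, the set `v ∷ J` is beyond the range of the invariant;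
    -- this boundary case is delegated to `top`.
    within-maker : ∀ τ {s u} → 0ℚ ≤ τ → Unique (breaker s) →
      (∀ {J v} → Unique J → All (Open u) J → v ∉ J → length J ≡ m → Within τ u J) →
      AllWithin (τ + β) s → MinDegStep a b s u → AllWithin τ u
    within-maker τ {s} {u} 0≤τ uB top p x@(claim v e (ov , max) _ i) {J} uJ oJ J≤m =
      split (DecMembership._∈?_ Fin._≟_ v J) (length J ℕ.≟ m)
      where
      oJ′ : All (Open s) J
      oJ′ = All.map (maker-open x) oJ
      split : Dec (v ∈ J) → Dec (length J ≡ m) → Within τ u J
      split (yes v∈J) _         = within-hit τ v∈J i (p uJ oJ′ J≤m)
      split (no v∉J)  (yes J≡m) = top uJ oJ v∉J J≡m
      split (no v∉J)  (no J≢m)  = within-miss τ 0≤τ uB v∉J (All.map (λ {w} → max w) oJ′)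
        (p (¬Any⇒All¬ J v∉J ∷ uJ) (ov ∷ oJ′) (ℕ.≤∧≢⇒< J≤m J≢m))

  -- From the danger of open vertices to final degrees.

  module Cap (C : ℚ) (0≤C : 0ℚ ≤ C)
    (open-bound : ∀ {s v} → MinDegPlay a b s → Open s v → α * dB s v ≤ γ * dM s v + C) where

    Capped : Position n → Fin n → Set
    Capped s v = α * dB s v ≤ γ * dM s v + (α * β + C)

    -- Only a vertex that was open at the start of Breaker's move can gain
    -- Breaker edges, so the bound for open vertices plus b caps them all.
    Pending : ℕ → Position n → Set
    Pending t s = (∀ v → Open s v → α * dB s v + ⟦ t ⟧ * α ≤ γ * dM s v + (α * β + C))
                × (∀ v → Capped s v)

    breaker-capped : ∀ {t s u} → Pending (suc t) s → BreakerStep s u → Pending t u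
    breaker-capped {t} {s} {u} (p , q) x@(claim e f) =
      (λ v o → opened v (breaker-open x o) (incident? v e)) , λ v → capped v (incident? v e)
      where
      dB-hit : ∀ {v} → Incident v e → dB u v ≡ 1ℚ + dB s v
      dB-hit {v} i = trans (cong ⟦_⟧ (trans (degree-∷ v e (breaker s))
        (cong (ℕ._+ degree v (breaker s)) (incident⇒inc i)))) (⟦⟧-suc (degree v (breaker s)))
      dB-miss : ∀ {v} → ¬ Incident v e → dB u v ≡ dB s v
      dB-miss {v} ¬i = cong ⟦_⟧ (trans (degree-∷ v e (breaker s))
        (cong (ℕ._+ degree v (breaker s)) (ℕ.n<1⇒n≡0 (ℕ.≰⇒> λ h → ¬i (inc⇒incident h)))))
      shift : ∀ α d t → α * (1ℚ + d) + t * α ≡ α * d + (1ℚ + t) * α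
      shift = solve-∀ ℚ-ring
      unshift : ∀ α d t → α * d + (1ℚ + t) * α - (α * d + t * α) ≡ α
      unshift = solve-∀ ℚ-ring
      unshift′ : ∀ α d t → α * d + (1ℚ + t) * α - α * (1ℚ + d) ≡ t * α
      unshift′ = solve-∀ ℚ-ring
      p′ : ∀ v → Open s v → α * dB s v + (1ℚ + ⟦ t ⟧) * α ≤ γ * dM s v + (α * β + C)
      p′ v o = resp-≤ (cong (λ k → α * dB s v + k * α) (sym (⟦⟧-suc t))) refl (p v o)
      opened : ∀ v → Open s v → Dec (Incident v e) → α * dB u v + ⟦ t ⟧ * α ≤ γ * dM s v + (α * β + C)
      opened v o (yes i) = resp-≤ (trans (cong (λ d → α * d + ⟦ t ⟧ * α) (dB-hit i)) (shift α (dB s v) ⟦ t ⟧))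
        refl (p′ v o)
      opened v o (no ¬i) = resp-≤ (cong (λ d → α * d + ⟦ t ⟧ * α) (dB-miss ¬i)) refl
        (≤-trans (by-gap α (unshift α (dB s v) ⟦ t ⟧) 0≤⟦ a ⟧) (p′ v o))
      capped : ∀ v → Dec (Incident v e) → Capped u v
      -- The edge just claimed was free before, so it witnesses that `v` was open.
      capped v (yes i) = resp-≤ (cong (α *_) (dB-hit i)) refl
        (≤-trans (by-gap (⟦ t ⟧ * α) (unshift′ α (dB s v) ⟦ t ⟧) (0≤⟦ t ⟧ ⊠ 0≤⟦ a ⟧)) (p′ v (e , f , i)))
      capped v (no ¬i) = resp-≤ (cong (α *_) (dB-miss ¬i)) refl (q v)

    maker-capped : ∀ {s u} → (∀ v → Capped s v) → MinDegStep a b s u → ∀ v → Capped u v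
    maker-capped {s} {u} p (claim _ e _ _ _) v = ≤-trans (p v)
      (+-monoˡ-≤ (α * β + C) (*-monoˡ-≤-nonNeg γ {{nonNegative 0≤⟦ 2 ℕ.* b ⟧}} (⟦⟧-mono-≤
        (ℕ.≤-trans (ℕ.m≤n+m _ (inc v e)) (ℕ.≤-reflexive (sym (degree-∷ v e (maker s))))))))

    capped-play : ∀ {s} → MinDegPlay a b s → ∀ v → Capped s v
    capped-play MinDegPlay.begin v = resp-≤
      (cong (α *_) ⟦0⟧) (cong (λ z → γ * z + (α * β + C)) ⟦0⟧)
      (by-gap (α * β + C) (vanish α γ (α * β + C)) (0≤⟦ a ⟧ ⊠ 0≤⟦ b ⟧ ⊞ 0≤C))
      where
      vanish : ∀ x y c → y * 0ℚ + c - x * 0ℚ ≡ c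
      vanish = solve-∀ ℚ-ring
    capped-play (round {s} {t} play bm mm) = run (λ _ u → ∀ v → Capped u v) maker-capped (λ _ p → p)
      (proj₂ (run Pending (λ {t} → breaker-capped {t}) (λ ex (_ , q) → (λ v (e , f , _) → contradiction f (ex e)) , q)
        -- Before Breaker's move `open-bound` leaves room for exactly `b` further edges at an open
        -- vertex.
        ((λ v o → by-gap _ (add α β (dB s v) (γ * dM s v) C) (gap (open-bound play o))) , capped-play play) bm)) mm
      where
      add : ∀ α β d m C → m + (α * β + C) - (α * d + β * α) ≡ m + C - α * d
      add = solve-∀ ℚ-ring

    -- A vertex of Maker degree below `k` would end with Breaker degree at least `n − k`, and its
    -- cap would then give the inequality that `small` excludes.
    capped-wins : ∀ k → ¬ (α * ⟦ n ⟧ ≤ γ * ⟦ k ⟧ + α * β + α * ⟦ k ⟧ + C) → MinDegStrategyWins n a b k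
    capped-wins k small s play ex = maker s , ⊆-refl , λ v → ℕ.≮⇒≥ λ d<k →
      small (by-gap _ (split α γ ⟦ n ⟧ ⟦ k ⟧ (dB s v) (dM s v) (α * β) C)
        (0≤⟦ a ⟧ ⊠ gap (subst (⟦ n ⟧ ≤_) (⟦⟧-+ k (degree v (breaker s)))
             -- Since `d<k` is strict, `k` absorbs the `suc` of `exhausted-degree`.
             (⟦⟧-mono-≤ (ℕ.≤-trans (exhausted-degree ex v) (ℕ.+-monoˡ-≤ (degree v (breaker s)) d<k))))
          ⊞ gap (capped-play play v)
          ⊞ 0≤⟦ 2 ℕ.* b ⟧ ⊠ gap (⟦⟧-mono-≤ (ℕ.<⇒≤ d<k))))
      where
      split : ∀ α γ n k B M x C → γ * k + x + α * k + C - α * n ≡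
        α * (k + B - n) + (γ * M + (x + C) - α * B) + γ * (k - M)
      split = solve-∀ ℚ-ring

  unique-breaker : ∀ {s u : Position n} → Unique (breaker s) → BreakerStep s u → Unique (breaker u)
  unique-breaker {s} uB (claim e (_ , e∉B)) = ¬Any⇒All¬ (breaker s) e∉B ∷ uB

  unique-maker : ∀ {s u : Position n} → Unique (breaker s) → MinDegStep a b s u → Unique (breaker u)
  unique-maker uB (claim _ _ _ _ _) = uB

  -- Averaging over large sets: both ends of a Breaker edge may lie in the set.
  module Large where

    φ : ℕ → ℚ
    φ j = γ * (H n - H j)

    0≤φ : ∀ {j} → j ℕ.≤ n → 0ℚ ≤ φ j
    0≤φ j≤n = 0≤⟦ 2 ℕ.* b ⟧ ⊠ gap (H-mono j≤n)

    E : List (Fin n) → List (Edge n) → ℚ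
    E _ _ = 0ℚ

    E-claim : ∀ {J} e es → Unique J → α * ⟦ hits J e ⟧ + E J es ≤ (1ℚ + 1ℚ) * α + E J (e ∷ es)
    E-claim {J} e es uJ = +-monoˡ-≤ 0ℚ (resp-≤ (*-comm α ⟦ hits J e ⟧)
      (cong (_* α) (sym (trans (⟦⟧-suc 1) (cong (λ z → 1ℚ + z) ⟦1⟧))))
      (*-monoʳ-≤-nonNeg α {{nonNegative 0≤⟦ a ⟧}} (⟦⟧-mono-≤ (hits≤2 e uJ))))

    E-grow : ∀ {v J es} → v ∉ J → Unique es → E (v ∷ J) es ≤ E J es + 0ℚ * ⟦ length J ⟧
    E-grow {J = J} _ _ = ≤-reflexive (sym (trans (+-identityˡ _) (*-zeroˡ ⟦ length J ⟧)))

    φ-step : ∀ j → (1ℚ + 1ℚ) * β + ⟦ suc j ⟧ * (0ℚ + φ (suc j)) ≤ ⟦ suc j ⟧ * φ j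
    φ-step j = ≤-reflexive (trans
      (cong (_+ ⟦ suc j ⟧ * (0ℚ + φ (suc j)))
        (trans (double β) (trans (sym γ≡2β) (sym (trans (cong (γ *_) (H-step j)) (*-identityʳ γ))))))
      (merge γ ⟦ suc j ⟧ (H n) (H j) (H (suc j))))
      where
      double : ∀ x → (1ℚ + 1ℚ) * x ≡ x + x
      double = solve-∀ ℚ-ring
      merge : ∀ γ k N h h′ → γ * (k * (h′ - h)) + k * (0ℚ + γ * (N - h′)) ≡ k * (γ * (N - h))
      merge = solve-∀ ℚ-ring

    open Budget (1ℚ + 1ℚ) 0ℚ n E φ (0≤1 ⊞ 0≤1) ≤-refl ≤-refl (λ _ _ → ≤-refl) E-claim
      (λ {v} {J} {es} → E-grow {v} {J} {es}) 0≤φ φ-step public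

    P : ℚ → Position n → Set
    P τ s = Unique (breaker s) × AllWithin τ s

    P-start : P 0ℚ start
    P-start = [] , within-start

    P-breaker : ∀ τ {s u} → P τ s → BreakerStep s u → P (τ + α) u
    P-breaker τ (uB , p) x = unique-breaker uB x , within-breaker τ p x

    P-maker : ∀ τ {s u} → 0ℚ ≤ τ → τ ≤ α * β → P (τ + β) s → MinDegStep a b s u → P τ u
    P-maker τ 0≤τ _ (uB , p) x = unique-maker uB x , within-maker τ 0≤τ uB
      -- A duplicate-free list of `n` vertices omits none, so the boundary case is void.
      (λ {J} uJ _ v∉J J≡n → contradiction
        (subst (λ k → suc k ℕ.≤ n) J≡n (unique-length≤ (¬Any⇒All¬ J v∉J ∷ uJ))) (ℕ.<-irrefl refl)) p x

    P-exhausted : ∀ τ τ′ {s} → Exhausted s → 0ℚ ≤ τ′ → P τ s → P τ′ s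
    P-exhausted τ τ′ ex 0≤τ′ (uB , _) = uB , within-exhausted τ′ ex 0≤τ′

    open Round P P-start P-breaker P-maker P-exhausted public

    open-bound : 1 ℕ.≤ n → ∀ {s v} → MinDegPlay a b s → Open s v → α * dB s v ≤ γ * dM s v + φ 1
    open-bound 1≤n {s} {v} play o = resp-≤
      (cong (λ d → α * ⟦ d ⟧) (sym (ℕ.+-identityʳ (degree v (breaker s)))))
      (trans (cong (λ d → γ * ⟦ d ⟧ + φ 1) (sym (ℕ.+-identityʳ (degree v (maker s)))))
        (trans (tidy (γ * volM s (v ∷ [])) (φ 1))
          (cong (λ z → γ * volM s (v ∷ []) + 0ℚ + (1ℚ + 1ℚ) * 0ℚ + z * φ 1) (sym ⟦1⟧))))
      (proj₂ (between-rounds play) ([] ∷ []) (o ∷ []) 1≤n)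
      where
      tidy : ∀ x p → x + p ≡ x + 0ℚ + (1ℚ + 1ℚ) * 0ℚ + 1ℚ * p
      tidy = solve-∀ ℚ-ring

  -- Averaging over sets of at most m vertices, where the Breaker edges inside
  -- the set are accounted for separately.
  module Small (m : ℕ) (C : ℚ) (m≤n : m ℕ.≤ n) (0≤C : 0ℚ ≤ C) (αβ≤mC : α * β ≤ ⟦ m ⟧ * C) where

    -- The harmonic gap pays for Breaker's move at unit charge, and `α * (m − j)` for the growth of
    -- `E`. At `j = m` both vanish, leaving the large-set bound and a reserve `C`.
    φ : ℕ → ℚ
    φ j = β * (H m - H j) + α * (⟦ m ⟧ - ⟦ j ⟧) + (Large.φ m + C)

    0≤φ : ∀ {j} → j ℕ.≤ m → 0ℚ ≤ φ j
    0≤φ j≤m = 0≤⟦ b ⟧ ⊠ gap (H-mono j≤m) ⊞ 0≤⟦ a ⟧ ⊠ gap (⟦⟧-mono-≤ j≤m) ⊞ (Large.0≤φ m≤n ⊞ 0≤C)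

    E : List (Fin n) → List (Edge n) → ℚ
    E J es = α * ⟦ inner J es ⟧

    0≤E : ∀ J es → 0ℚ ≤ E J es
    0≤E J es = 0≤⟦ a ⟧ ⊠ 0≤⟦ inner J es ⟧

    E-claim : ∀ {J} e es → Unique J → α * ⟦ hits J e ⟧ + E J es ≤ 1ℚ * α + E J (e ∷ es)
    E-claim {J} e es _ = resp-≤ refl
      (cong (λ z → 1ℚ * α + α * z) (⟦⟧-+ (hits J e ℕ.∸ 1) (inner J es)))
      (by-gap _ (split α ⟦ hits J e ⟧ ⟦ hits J e ℕ.∸ 1 ⟧ ⟦ inner J es ⟧)
        (0≤⟦ a ⟧ ⊠ gap (subst (⟦ hits J e ⟧ ≤_) (⟦⟧-suc (hits J e ℕ.∸ 1))
          (⟦⟧-mono-≤ (ℕ.m≤n+m∸n (hits J e) 1)))))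
      where
      split : ∀ α h h′ I → 1ℚ * α + α * (h′ + I) - (α * h + α * I) ≡ α * (1ℚ + h′ - h)
      split = solve-∀ ℚ-ring

    E-grow : ∀ {v J es} → v ∉ J → Unique es → E (v ∷ J) es ≤ E J es + α * ⟦ length J ⟧
    E-grow {v} {J} {es} v∉J u = resp-≤ refl
      (trans (sym (*-distribˡ-+ α ⟦ inner J es ⟧ ⟦ length J ⟧)) (cong (α *_) (sym (⟦⟧-+ (inner J es) (length J)))))
      (*-monoˡ-≤-nonNeg α {{nonNegative 0≤⟦ a ⟧}} (⟦⟧-mono-≤ (inner-grow v∉J u)))

    φ-step : ∀ j → 1ℚ * β + ⟦ suc j ⟧ * (α + φ (suc j)) ≤ ⟦ suc j ⟧ * φ j
    φ-step j = ≤-reflexive (trans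
      (cong₂ (λ y z → y * β + ⟦ suc j ⟧ * (α + (β * (H m - H (suc j)) + α * (⟦ m ⟧ - z) + (Large.φ m + C))))
        (sym (H-step j)) (⟦⟧-suc j))
      (merge α β ⟦ suc j ⟧ ⟦ m ⟧ (⟦ j ⟧) (H m) (H j) (H (suc j)) (Large.φ m + C)))
      where
      merge : ∀ α β k m j M h h′ p → k * (h′ - h) * β + k * (α + (β * (M - h′) + α * (m - (1ℚ + j)) + p)) ≡
              k * (β * (M - h) + α * (m - j) + p)
      merge = solve-∀ ℚ-ring

    open Budget 1ℚ α m E φ 0≤1 (≤-trans (≤-reflexive (sym (+-identityʳ 1ℚ))) (+-monoʳ-≤ 1ℚ 0≤1)) 0≤⟦ a ⟧
      0≤E E-claim E-grow 0≤φ φ-step public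

    P : ℚ → Position n → Set
    P τ s = Large.P τ s × AllWithin τ s

    -- The large-set bound charges the unanswered part twice, the small-set bound once. The
    -- difference `τ ≤ α * β` is covered by the total reserve `m * C`.
    large⇒small : ∀ τ {s J} → 0ℚ ≤ τ → τ ≤ α * β → Large.AllWithin τ s →
                  Unique J → All (Open s) J → length J ≡ m → Within τ s J
    large⇒small τ {s} {J} 0≤τ τ≤ p uJ oJ J≡m = resp-≤ refl (cong (λ k → γ * volM s J + E J (breaker s) + 1ℚ * τ + ⟦ k ⟧ * φ k) J≡m)
      (by-gap _ (split α β ⟦ m ⟧ (H m) (Large.φ m) C τ (γ * volM s J) (E J (breaker s)) (α * volB s J))
        (gap (subst (λ k → α * volB s J ≤ γ * volM s J + 0ℚ + (1ℚ + 1ℚ) * τ + ⟦ k ⟧ * Large.φ k) J≡m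
                (p uJ oJ (unique-length≤ uJ)))
          ⊞ 0≤E J (breaker s) ⊞ gap αβ≤mC ⊞ gap τ≤))
      where
      split : ∀ α β m h p C τ U E V → U + E + 1ℚ * τ + m * (β * (h - h) + α * (m - m) + (p + C)) - V ≡
        (U + 0ℚ + (1ℚ + 1ℚ) * τ + m * p - V) + E + (m * C - α * β) + (α * β - τ)
      split = solve-∀ ℚ-ring

    P-start : P 0ℚ start
    P-start = Large.P-start , within-start

    P-breaker : ∀ τ {s u} → P τ s → BreakerStep s u → P (τ + α) u
    P-breaker τ (l , p) x = Large.P-breaker τ l x , within-breaker τ p x

    P-maker : ∀ τ {s u} → 0ℚ ≤ τ → τ ≤ α * β → P (τ + β) s → MinDegStep a b s u → P τ u
    -- The large-set invariant advances first, since sets of `m` vertices take their bound at the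
    -- new position from it.
    P-maker τ {s} {u} 0≤τ τ≤ (l , p) x = l′ , within-maker τ 0≤τ (proj₁ l)
      (λ uJ oJ _ J≡m → large⇒small τ 0≤τ τ≤ (proj₂ l′) uJ oJ J≡m) p x
      where
      l′ : Large.P τ u
      l′ = Large.P-maker τ 0≤τ τ≤ l x

    P-exhausted : ∀ τ τ′ {s} → Exhausted s → 0ℚ ≤ τ′ → P τ s → P τ′ s
    P-exhausted τ τ′ ex 0≤τ′ (l , _) = Large.P-exhausted τ τ′ ex 0≤τ′ l , within-exhausted τ′ ex 0≤τ′

    open Round P P-start P-breaker P-maker P-exhausted public

    open-bound : 1 ℕ.≤ m → ∀ {s v} → MinDegPlay a b s → Open s v → α * dB s v ≤ γ * dM s v + φ 1
    open-bound 1≤m {s} {v} play o = resp-≤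
      (cong (λ d → α * ⟦ d ⟧) (sym (ℕ.+-identityʳ (degree v (breaker s)))))
      (trans (cong (λ d → γ * ⟦ d ⟧ + φ 1) (sym (ℕ.+-identityʳ (degree v (maker s)))))
        (trans (tidy (γ * volM s (v ∷ [])) α (φ 1))
          (cong₂ (λ y z → γ * volM s (v ∷ []) + α * y + 1ℚ * 0ℚ + z * φ 1)
             (sym (trans (cong ⟦_⟧ (inner-singleton v (breaker s))) ⟦0⟧)) (sym ⟦1⟧))))
      (proj₂ (between-rounds play) ([] ∷ []) (o ∷ []) 1≤m)
      where
      tidy : ∀ x α p → x + p ≡ x + α * 0ℚ + 1ℚ * 0ℚ + 1ℚ * p
      tidy = solve-∀ ℚ-ring

  large-wins : ∀ k → 1 ℕ.≤ n →
    ¬ (α * ⟦ n ⟧ ≤ γ * ⟦ k ⟧ + α * β + α * ⟦ k ⟧ + γ * (H n - H 1)) →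
    MinDegStrategyWins n a b k
  large-wins k 1≤n = Cap.capped-wins (Large.φ 1) (Large.0≤φ 1≤n) (Large.open-bound 1≤n) k

  small-wins : ∀ k m C → 1 ℕ.≤ m → m ℕ.≤ n → 0ℚ ≤ C → α * β ≤ ⟦ m ⟧ * C →
    ¬ (α * ⟦ n ⟧ ≤ γ * ⟦ k ⟧ + α * β + α * ⟦ k ⟧
         + (β * (H m - H 1) + α * (⟦ m ⟧ - ⟦ 1 ⟧) + (γ * (H n - H m) + C))) →
    MinDegStrategyWins n a b k
  small-wins k m C 1≤m m≤n 0≤C le = Cap.capped-wins (φ 1) (0≤φ 1≤m) (open-bound 1≤m) k
    where open Small m C m≤n 0≤C le

-- Harmonic numbers against the logarithm, and their growth.

archimedean : ∀ x → ∃[ m ] x ≤ ⟦ m ⟧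
archimedean x@(mkℚ i d _) = ℤ.∣ i ∣ , subst (x ≤_) (sym (⟦⟧≡fromℕ ℤ.∣ i ∣))
  (toℚᵘ-cancel-≤ (ℚᵘ.≤-respʳ-≃ (ℚᵘ.≃-sym (toℚᵘ-fromℕ ℤ.∣ i ∣)) (*≤* (bound i))))
  where
  bound : ∀ i → i ℤ.* + 1 ℤ.≤ + ℤ.∣ i ∣ ℤ.* + suc d
  bound (+ m)        = ℤ.*-monoˡ-≤-nonNeg (+ m) (ℤ.+≤+ (s≤s z≤n))
  bound (ℤ.-[1+ m ]) = ℤ.-≤+

-- The integer `suc d` stands in for 1/ε in the later constants, which keeps the certificates free
-- of division.
scale : ∀ ε → 0ℚ < ε → ∃[ d ] 1ℚ ≤ ε * ⟦ suc d ⟧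
scale ε 0<ε = proj₁ arch , subst (_≤ ε * ⟦ suc (proj₁ arch) ⟧) (*-inverseʳ ε)
  (*-monoˡ-≤-nonNeg ε {{pos⇒nonNeg ε}} (≤-trans (proj₂ arch) (⟦⟧-mono-≤ (ℕ.n≤1+n (proj₁ arch)))))
  where
  instance
    ε-pos : Positive ε
    ε-pos = positive 0<ε
    ε-nonZero : ℚ.NonZero ε
    ε-nonZero = pos⇒nonZero ε
  arch : ∃[ m ] 1/ ε ≤ ⟦ m ⟧
  arch = archimedean (1/ ε)

eventually-∧ : ∀ {P Q : ℕ → Set} → Eventually P → Eventually Q → Eventually λ n → P n × Q n
eventually-∧ (M , p) (N , q) = M ℕ.⊔ N , λ n M⊔N≤n →
  p n (ℕ.≤-trans (ℕ.m≤m⊔n M N) M⊔N≤n) , q n (ℕ.≤-trans (ℕ.m≤n⊔m M N) M⊔N≤n)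

∑-snoc : ∀ l (f : ℕ → ℚ) → ∑[ suc l ] f ≡ ∑[ l ] f + f l
∑-snoc zero    f = +-comm (f 0) 0ℚ
∑-snoc (suc l) f = trans (cong (λ x → f 0 + x) (∑-snoc l (λ i → f (suc i))))
  (sym (+-assoc (f 0) (∑[ l ] (λ i → f (suc i))) (f (suc l))))

∑-recip : ∀ l → ∑[ l ] (λ i → + 1 / suc i) ≡ H l
∑-recip zero    = sym H-zero
∑-recip (suc l) = trans (∑-snoc l (λ i → + 1 / suc i))
  (trans (cong (_+ (+ 1 / suc l)) (∑-recip l)) (sym (H-suc l)))

-- At mesh 1 the Riemann sums of the logarithm are harmonic sums; the real inequalities are
-- instantiated there.
lnUpper-H : ∀ n → lnUpper n 0 ≡ H (n ℕ.∸ 1)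
lnUpper-H n = trans (∑-recip ((n ℕ.∸ 1) ℕ.* 1)) (cong H (ℕ.*-identityʳ (n ℕ.∸ 1)))

lnLower-H : ∀ n → 1 ℕ.≤ n → lnLower n 0 ≡ H n - H 1
lnLower-H (suc n) _ = trans (shifted (n ℕ.* 1)) (cong (λ k → H (suc k) - H 1) (ℕ.*-identityʳ n))
  where
  move : ∀ x y r → x - y + r ≡ x + r - y
  move = solve-∀ ℚ-ring
  shifted : ∀ l → ∑[ l ] (λ i → + 1 / suc (suc i)) ≡ H (suc l) - H 1
  shifted zero    = sym (+-inverseʳ (H 1))
  shifted (suc l) = trans (∑-snoc l (λ i → + 1 / suc (suc i)))
    (trans (cong (_+ (+ 1 / suc (suc l))) (shifted l))
    (trans (move (H (suc l)) (H 1) (+ 1 / suc (suc l))) (cong (_- H 1) (sym (H-suc (suc l))))))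

H-one : H 1 ≡ 1ℚ
H-one = trans (sym (∑-recip 1)) refl

-- Each of the `i` terms in the gap is at most 1/m; the product form makes sense for `m = 0` too.
H-gap-≤ : ∀ m i → ⟦ m ⟧ * (H (m ℕ.+ i) - H m) ≤ ⟦ i ⟧
H-gap-≤ m zero = resp-≤ (cong (λ k → ⟦ m ⟧ * (H k - H m)) (ℕ.+-identityʳ m)) ⟦0⟧
  (≤-reflexive (vanish ⟦ m ⟧ (H m)))
  where
  vanish : ∀ m h → m * (h - h) ≡ 0ℚ
  vanish = solve-∀ ℚ-ring
H-gap-≤ m (suc i) = resp-≤
  (cong (λ k → ⟦ m ⟧ * (k - H m)) (trans (cong H (ℕ.+-suc m i)) (H-suc (m ℕ.+ i)))) (⟦⟧-suc i)
  (by-gap _ (trans (split ⟦ m ⟧ (H (m ℕ.+ i)) (H m) ⟦ i ⟧ r)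
      (cong (_+ (⟦ i ⟧ - ⟦ m ⟧ * (H (m ℕ.+ i) - H m))) (cong (_- ⟦ m ⟧ * r) (sym (recip-cancel (m ℕ.+ i))))))
    (gap (*-monoʳ-≤-nonNeg r {{nonNegative (0≤recip (m ℕ.+ i))}} (⟦⟧-mono-≤ (ℕ.m≤n⇒m≤1+n (ℕ.m≤m+n m i))))
     ⊞ gap (H-gap-≤ m i)))
  where
  r : ℚ
  r = + 1 / suc (m ℕ.+ i)
  split : ∀ m h h′ i r → 1ℚ + i - m * (h + r - h′) ≡ (1ℚ - m * r) + (i - m * (h - h′))
  split = solve-∀ ℚ-ring

-- Each of the `i` terms in the gap is at least 1/(m + i).
H-gap-≥ : ∀ m i → ⟦ i ⟧ ≤ ⟦ m ℕ.+ i ⟧ * (H (m ℕ.+ i) - H m)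
H-gap-≥ m zero = resp-≤ ⟦0⟧ (cong (λ k → ⟦ k ⟧ * (H k - H m)) (ℕ.+-identityʳ m))
  (≤-reflexive (vanish ⟦ m ⟧ (H m)))
  where
  vanish : ∀ m h → 0ℚ ≡ m * (h - h)
  vanish = solve-∀ ℚ-ring
H-gap-≥ m (suc i) = resp-≤ (⟦⟧-suc i) (cong (λ k → ⟦ k ⟧ * (H k - H m)) (ℕ.+-suc m i))
  (by-gap _ (trans
      (cong₂ (λ x y → x * (H (suc k) - H m) - (y + ⟦ i ⟧)) (⟦⟧-suc k)
        (sym (trans (cong (_* (H (suc k) - H k)) (sym (⟦⟧-suc k))) (H-step k))))
      (split ⟦ k ⟧ (H (suc k)) (H k) (H m) ⟦ i ⟧))
    (gap (H-gap-≥ m i) ⊞ gap (H-mono (ℕ.m≤m+n m i))))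
  where
  k : ℕ
  k = m ℕ.+ i
  split : ∀ k h⁺ h h′ i → (1ℚ + k) * (h⁺ - h′) - ((1ℚ + k) * (h⁺ - h) + i) ≡
          (k * (h - h′) - i) + (h - h′)
  split = solve-∀ ℚ-ring

H-doubling : ∀ j → H (suc j) + ½ ≤ H (suc j ℕ.+ suc j)
H-doubling j = by-scaled-gap ⟦ k ⟧ {{⟦suc⟧-pos j}} (½ * (⟦ k ℕ.+ k ⟧ * (H (k ℕ.+ k) - H k) - ⟦ k ⟧))
  (sym (trans (cong (λ x → ½ * (x * (H (k ℕ.+ k) - H k) - ⟦ k ⟧)) (⟦⟧-+ k k))
              (split ⟦ k ⟧ (H (k ℕ.+ k)) (H k))))
  (nonNegative⁻¹ ½ ⊠ gap (H-gap-≥ k k))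
  where
  k : ℕ
  k = suc j
  split : ∀ k h h′ → ½ * ((k + k) * (h - h′) - k) ≡ k * (h - (h′ + ½))
  split = solve-∀ ℚ-ring

H-unbounded : ∀ x → Eventually λ n → x ≤ H n
H-unbounded x = suc (proj₁ (reach t)) , λ n N≤n → ≤-trans (≤-trans below (proj₂ (reach t))) (H-mono N≤n)
  where
  t : ℕ
  -- Each doubling of the index gains at least ½, so 2x doublings reach `x`.
  t = proj₁ (archimedean (x + x))
  halve : ∀ x → ½ * (x + x) ≡ x
  halve = solve-∀ ℚ-ring
  below : x ≤ ½ * ⟦ t ⟧
  below = subst (_≤ ½ * ⟦ t ⟧) (halve x) (*-monoˡ-≤-nonNeg ½ (proj₂ (archimedean (x + x))))
  reach : ∀ t → ∃[ j ] ½ * ⟦ t ⟧ ≤ H (suc j)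
  reach zero = 0 , resp-≤ (trans (cong (½ *_) ⟦0⟧) (*-zeroʳ ½)) H-one 0≤1
  reach (suc t) = proj₁ (reach t) ℕ.+ suc (proj₁ (reach t)) , ≤-trans
    (resp-≤ (trans (cong (½ *_) (⟦⟧-suc t)) (half-more ⟦ t ⟧)) refl (+-monoˡ-≤ ½ (proj₂ (reach t))))
    (H-doubling (proj₁ (reach t)))
    where
    half-more : ∀ t → ½ * (1ℚ + t) ≡ ½ * t + ½
    half-more = solve-∀ ℚ-ring

recip≤1 : ∀ j → + 1 / suc j ≤ 1ℚ
recip≤1 j = by-gap _
  (trans (cong (_- + 1 / suc j) (sym (trans (cong (_* (+ 1 / suc j)) (sym (⟦⟧-suc j))) (recip-cancel j))))
         (drop ⟦ j ⟧ (+ 1 / suc j)))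
  (0≤⟦ j ⟧ ⊠ 0≤recip j)
  where
  drop : ∀ j r → (1ℚ + j) * r - r ≡ j * r
  drop = solve-∀ ℚ-ring

H≤ : ∀ n → H n ≤ ⟦ n ⟧
H≤ zero    = ≤-reflexive (trans H-zero (sym ⟦0⟧))
H≤ (suc n) = resp-≤ (H-suc n) (trans (⟦⟧-suc n) (+-comm 1ℚ ⟦ n ⟧)) (+-mono-≤ (H≤ n) (recip≤1 n))

0≤H : ∀ n → 0ℚ ≤ H n
0≤H n = subst (_≤ H n) H-zero (H-mono z≤n)

-- With x = H n and r = 1/(n+1), the increment of x^(p+1) is bounded by the
-- bounds x^i ≤ C_i n for i ≤ p, because n r ≤ 1.
module Powers (N x r : ℚ) (0≤x : 0ℚ ≤ x) (0≤r : 0ℚ ≤ r) (r≤1 : r ≤ 1ℚ) (Nr≤1 : N * r ≤ 1ℚ)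
  (x≤ : x ≤ N) where

  square : x * x ≤ fromℕ 3 * N → (x + r) * (x + r) ≤ fromℕ 3 * (1ℚ + N)
  square x²≤ = by-gap _ (split N x r)
    (gap x²≤ ⊞ 0≤fromℕ 2 ⊠ (gap x≤ ⊠ 0≤r) ⊞ 0≤fromℕ 2 ⊠ gap Nr≤1 ⊞ gap r≤1 ⊠ (0≤1 ⊞ 0≤r))
    where
    split : ∀ N x r → fromℕ 3 * (1ℚ + N) - (x + r) * (x + r) ≡
      (fromℕ 3 * N - x * x) + fromℕ 2 * ((N - x) * r) + fromℕ 2 * (1ℚ - N * r) + (1ℚ - r) * (1ℚ + r)
    split = solve-∀ ℚ-ring

  cube : x * x ≤ fromℕ 3 * N → x * x * x ≤ fromℕ 13 * N →
         (x + r) * (x + r) * (x + r) ≤ fromℕ 13 * (1ℚ + N)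
  cube x²≤ x³≤ = by-gap _ (split N x r)
    (gap x³≤ ⊞ 0≤fromℕ 3 ⊠ (gap x²≤ ⊠ 0≤r) ⊞ 0≤fromℕ 9 ⊠ gap Nr≤1
      ⊞ 0≤fromℕ 3 ⊠ (gap x≤ ⊠ 0≤r ⊠ 0≤r) ⊞ 0≤fromℕ 3 ⊠ (gap Nr≤1 ⊠ 0≤r) ⊞ 0≤fromℕ 3 ⊠ gap r≤1
      ⊞ gap r≤1 ⊠ (0≤1 ⊞ 0≤r ⊞ 0≤r ⊠ 0≤r))
    where
    split : ∀ N x r → fromℕ 13 * (1ℚ + N) - (x + r) * (x + r) * (x + r) ≡
      (fromℕ 13 * N - x * x * x) + fromℕ 3 * ((fromℕ 3 * N - x * x) * r) + fromℕ 9 * (1ℚ - N * r)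
      + fromℕ 3 * ((N - x) * r * r) + fromℕ 3 * ((1ℚ - N * r) * r) + fromℕ 3 * (1ℚ - r)
      + (1ℚ - r) * (1ℚ + r + r * r)
    split = solve-∀ ℚ-ring

  fourth : x * x ≤ fromℕ 3 * N → x * x * x ≤ fromℕ 13 * N → x * x * x * x ≤ fromℕ 75 * N →
           (x + r) * (x + r) * (x + r) * (x + r) ≤ fromℕ 75 * (1ℚ + N)
  fourth x²≤ x³≤ x⁴≤ = by-gap _ (split N x r)
    (gap x⁴≤ ⊞ 0≤fromℕ 4 ⊠ (gap x³≤ ⊠ 0≤r) ⊞ 0≤fromℕ 52 ⊠ gap Nr≤1
      ⊞ 0≤fromℕ 6 ⊠ (gap x²≤ ⊠ 0≤r ⊠ 0≤r) ⊞ 0≤fromℕ 18 ⊠ (gap Nr≤1 ⊠ 0≤r) ⊞ 0≤fromℕ 18 ⊠ gap r≤1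
      ⊞ 0≤fromℕ 4 ⊠ (gap x≤ ⊠ 0≤r ⊠ 0≤r ⊠ 0≤r) ⊞ 0≤fromℕ 4 ⊠ (gap Nr≤1 ⊠ 0≤r ⊠ 0≤r)
      ⊞ 0≤fromℕ 4 ⊠ (gap r≤1 ⊠ (0≤1 ⊞ 0≤r))
      ⊞ gap r≤1 ⊠ (0≤1 ⊞ 0≤r ⊞ 0≤r ⊠ 0≤r ⊞ 0≤r ⊠ 0≤r ⊠ 0≤r))
    where
    split : ∀ N x r → fromℕ 75 * (1ℚ + N) - (x + r) * (x + r) * (x + r) * (x + r) ≡
      (fromℕ 75 * N - x * x * x * x) + fromℕ 4 * ((fromℕ 13 * N - x * x * x) * r) + fromℕ 52 * (1ℚ - N * r)
      + fromℕ 6 * ((fromℕ 3 * N - x * x) * r * r) + fromℕ 18 * ((1ℚ - N * r) * r) + fromℕ 18 * (1ℚ - r)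
      + fromℕ 4 * ((N - x) * r * r * r) + fromℕ 4 * ((1ℚ - N * r) * r * r)
      + fromℕ 4 * ((1ℚ - r) * (1ℚ + r))
      + (1ℚ - r) * (1ℚ + r + r * r + r * r * r)
    split = solve-∀ ℚ-ring

-- With `C_0 = C_1 = 1`, the constants follow `C_p = Σ binom(p,i) C_i` over `i < p`, which gives 3,
-- 13 and 75. The fourth power is the one needed to compare `a` with `H n`.
H-powers : ∀ n → (H n * H n ≤ fromℕ 3 * ⟦ n ⟧) × (H n * H n * H n ≤ fromℕ 13 * ⟦ n ⟧)
               × (H n * H n * H n * H n ≤ fromℕ 75 * ⟦ n ⟧)
H-powers zero = at-zero (H 0) 3 , at-zero (H 0 * H 0) 13 , at-zero (H 0 * H 0 * H 0) 75
  where
  at-zero : ∀ x k → x * H 0 ≤ fromℕ k * ⟦ 0 ⟧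
  at-zero x k = resp-≤ (trans (cong (x *_) H-zero) (*-zeroʳ x))
    (trans (cong (fromℕ k *_) ⟦0⟧) (*-zeroʳ (fromℕ k))) ≤-refl
H-powers (suc n) with H-powers n
... | x²≤ , x³≤ , x⁴≤ =
    resp-≤ (cong (λ x → x * x) (H-suc n)) (cong (fromℕ 3 *_) (⟦⟧-suc n)) (square x²≤)
  , resp-≤ (cong (λ x → x * x * x) (H-suc n)) (cong (fromℕ 13 *_) (⟦⟧-suc n)) (cube x²≤ x³≤)
  , resp-≤ (cong (λ x → x * x * x * x) (H-suc n)) (cong (fromℕ 75 *_) (⟦⟧-suc n)) (fourth x²≤ x³≤ x⁴≤)
  where
  r : ℚ
  r = + 1 / suc n
  nr≤1 : ⟦ n ⟧ * r ≤ 1ℚ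
  nr≤1 = subst (⟦ n ⟧ * r ≤_) (recip-cancel n)
    (*-monoʳ-≤-nonNeg r {{nonNegative (0≤recip n)}} (⟦⟧-mono-≤ (ℕ.n≤1+n n)))
  open Powers ⟦ n ⟧ (H n) r (0≤H n) (0≤recip n) (recip≤1 n) nr≤1 (H≤ n)

-- Numerical contradictions in the two ranges of `a`.

⟦⟧-numeral-* : ∀ c m → ⟦ c ℕ.* m ⟧ ≡ fromℕ c * ⟦ m ⟧
⟦⟧-numeral-* c m = trans (⟦⟧-* c m) (cong (_* ⟦ m ⟧) (⟦⟧≡fromℕ c))

0<⟦⟧ : ∀ {m} → 1 ℕ.≤ m → 0ℚ < ⟦ m ⟧
0<⟦⟧ {suc m} _ = positive⁻¹ ⟦ suc m ⟧ {{⟦suc⟧-pos m}}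

infixl 7 _⊠⁺_
_⊠⁺_ : ∀ {x y} → 0ℚ < x → 0ℚ < y → 0ℚ < x * y
_⊠⁺_ {x} {y} p q = positive⁻¹ (x * y) {{pos*pos⇒pos x {{positive p}} y {{positive q}}}}

clear-denominator : ∀ c .{{_ : NonZero c}} {x y} → x ≤ (+ 1 / c) * y → ⟦ c ⟧ * x ≤ y
clear-denominator c {x} {y} p = subst (⟦ c ⟧ * x ≤_)
  (trans (reorder ⟦ c ⟧ (+ 1 / c) y) (trans (cong (_* y) (trans (/-cancel-⟦⟧ 1 c) ⟦1⟧)) (*-identityˡ y)))
  (*-monoˡ-≤-nonNeg ⟦ c ⟧ {{nonNegative 0≤⟦ c ⟧}} p)
  where
  reorder : ∀ c r y → c * (r * y) ≡ r * c * y
  reorder = solve-∀ ℚ-ring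

H∸1≤H : ∀ n → H (n ℕ.∸ 1) ≤ H n
H∸1≤H n = H-mono (ℕ.m∸n≤m n 1)

o-ln-bound : ∀ c .{{_ : NonZero c}} {k n} → fromℕ k ≤ᵣ (+ 1 / c) ·ln n → ⟦ c ⟧ * ⟦ k ⟧ ≤ H n
o-ln-bound c {k} {n} p = ≤-trans
  (clear-denominator c (resp-≤ (⟦⟧≡fromℕ k) (cong ((+ 1 / c) *_) (sym (lnUpper-H n))) (p 0)))
  (H∸1≤H n)

o-bound : ∀ c .{{_ : NonZero c}} {k m} → fromℕ k ≤ (+ 1 / c) * fromℕ m → ⟦ c ⟧ * ⟦ k ⟧ ≤ ⟦ m ⟧
o-bound c {k} {m} p = clear-denominator c
  (resp-≤ (⟦⟧≡fromℕ k) (cong ((+ 1 / c) *_) (⟦⟧≡fromℕ m)) p)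

-- Count in units of `αN/(8D)`. The bias condition makes `α(N − β)` at least 8 units, while `2βk`,
-- `αk` and `2βx` take at most 2, 1 and 2. Three positive units remain.
large-absurd : ∀ {α β D N k x x₁} → 0ℚ < α → 0ℚ < N → 0ℚ ≤ β → 0ℚ ≤ D → 0ℚ ≤ x₁ →
  D * β ≤ (D - 1ℚ) * N → β ≤ N →
  fromℕ 8 * D * k ≤ N → fromℕ 8 * D * k ≤ α → fromℕ 8 * D * x ≤ α →
  ¬ (α * N ≤ (β + β) * k + α * β + α * k + (β + β) * (x - x₁))
large-absurd {α} {β} {D} {N} {k} {x} {x₁} 0<α 0<N 0≤β 0≤D 0≤x₁ h₁ h₂ h₃ h₄ h₅ h =
  <-irrefl refl (<-≤-trans (positive⁻¹ (fromℕ 3) ⊠⁺ (0<α ⊠⁺ 0<N)) (by-gap _ (split α β D N k x x₁)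
    (0≤fromℕ 8 ⊠ 0≤D ⊠ gap h ⊞ 0≤fromℕ 8 ⊠ 0≤α ⊠ gap h₁ ⊞ 0≤fromℕ 4 ⊠ 0≤α ⊠ gap h₂
      ⊞ 0≤α ⊠ gap h₃ ⊞ 0≤fromℕ 2 ⊠ 0≤β ⊠ gap h₄ ⊞ 0≤fromℕ 2 ⊠ 0≤β ⊠ gap h₅
      ⊞ 0≤fromℕ 16 ⊠ 0≤D ⊠ 0≤β ⊠ 0≤x₁)))
  where
  0≤α : 0ℚ ≤ α
  0≤α = <⇒≤ 0<α
  split : ∀ α β D N k x x₁ → 0ℚ - fromℕ 3 * (α * N) ≡
    fromℕ 8 * D * ((β + β) * k + α * β + α * k + (β + β) * (x - x₁) - α * N)
    + fromℕ 8 * α * ((D - 1ℚ) * N - D * β) + fromℕ 4 * α * (N - β)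
    + α * (N - fromℕ 8 * D * k) + fromℕ 2 * β * (α - fromℕ 8 * D * k) + fromℕ 2 * β * (α - fromℕ 8 * D * x)
    + fromℕ 16 * D * β * x₁
  split = solve-∀ ℚ-ring

-- Count in units of `αN/(16D)`. The bias condition leaves 16 units after `αβ` and `β(x − 1)`. The
-- remaining terms `2βk`, `αk`, `β(x − y)`, `αM` and `16Dα` take at most 2, 1, 2, 2 and 2.
-- Strictness comes from the `−1` in `α(M − 1)`.
small-absurd : ∀ {α β D N k x y M} → 0ℚ < α → 0ℚ < D → 0ℚ ≤ β → 0ℚ ≤ N →
  D * (β * (x - 1ℚ) + α * β) ≤ (D - 1ℚ) * (α * N) → β * (x - 1ℚ) ≤ α * N →
  x - y ≤ fromℕ 16 * D → fromℕ 16 * D * k ≤ x - 1ℚ → fromℕ 8 * D * M ≤ N →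
  fromℕ 128 * (D * D) ≤ x - 1ℚ → x - 1ℚ ≤ N →
  ¬ (α * N ≤ (β + β) * k + α * β + α * k
       + (β * (y - 1ℚ) + α * (M - 1ℚ) + ((β + β) * (x - y) + fromℕ 16 * D * α)))
small-absurd {α} {β} {D} {N} {k} {x} {y} {M} 0<α 0<D 0≤β 0≤N h₂ h₈ h₃ h₄ h₅ h₆ h₇ h =
  <-irrefl refl (<-≤-trans (positive⁻¹ (fromℕ 16) ⊠⁺ (0<D ⊠⁺ 0<α)) (by-gap _ (split α β D N k x y M)
    (0≤fromℕ 16 ⊠ 0≤D ⊠ gap h ⊞ 0≤fromℕ 16 ⊠ gap h₂ ⊞ (0≤fromℕ 2 ⊠ 0≤β ⊞ 0≤α) ⊠ gap h₄
      ⊞ 0≤fromℕ 16 ⊠ D*β ⊠ gap h₃ ⊞ (0≤fromℕ 2 ⊠ 0≤β ⊞ 0≤fromℕ 2 ⊠ 0≤α) ⊠ gap h₆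
      ⊞ 0≤fromℕ 2 ⊠ 0≤α ⊠ gap h₅ ⊞ 0≤fromℕ 4 ⊠ gap h₈ ⊞ 0≤fromℕ 3 ⊠ 0≤α ⊠ gap h₇
      ⊞ 0≤fromℕ 7 ⊠ (0≤α ⊠ 0≤N))))
  where
  0≤α : 0ℚ ≤ α
  0≤α = <⇒≤ 0<α
  0≤D : 0ℚ ≤ D
  0≤D = <⇒≤ 0<D
  D*β : 0ℚ ≤ D * β
  D*β = 0≤D ⊠ 0≤β
  split : ∀ α β D N k x y M → 0ℚ - fromℕ 16 * (D * α) ≡
    fromℕ 16 * D * ((β + β) * k + α * β + α * k
       + (β * (y - 1ℚ) + α * (M - 1ℚ) + ((β + β) * (x - y) + fromℕ 16 * D * α)) - α * N)
    + fromℕ 16 * ((D - 1ℚ) * (α * N) - D * (β * (x - 1ℚ) + α * β))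
    + (fromℕ 2 * β + α) * (x - 1ℚ - fromℕ 16 * D * k)
    + fromℕ 16 * (D * β) * (fromℕ 16 * D - (x - y))
    + (fromℕ 2 * β + fromℕ 2 * α) * (x - 1ℚ - fromℕ 128 * (D * D))
    + fromℕ 2 * α * (N - fromℕ 8 * D * M)
    + fromℕ 4 * (α * N - β * (x - 1ℚ))
    + fromℕ 3 * α * (N - (x - 1ℚ))
    + fromℕ 7 * (α * N)
  split = solve-∀ ℚ-ring

-- Here `x` is `H n` and `E` bounds 1/c. The hypotheses give `75E²α² ≥ x³`, which is at least
-- `75E²(8Dx)²` once `x ≥ 4800D²E²`, as 4800 = 75 · 64. If `α` were below `8Dx`, the difference of
-- the squares would be positive.
H≪a : ∀ {α N c D E x} → 0ℚ ≤ α → 0ℚ < D → 0ℚ < E → 0ℚ < x → 1ℚ ≤ c * E → 0ℚ ≤ c →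
  c * c * N ≤ α * α * x → x * x * x * x ≤ fromℕ 75 * N →
  fromℕ 4800 * (D * D) * (E * E) ≤ x → fromℕ 8 * D * x ≤ α
H≪a {α} {N} {c} {D} {E} {x} 0≤α 0<D 0<E 0<x 1≤cE 0≤c h₁ h₂ h₃ = ≮⇒≥ λ α<y →
  <-irrefl refl (<-≤-trans
    (0<gap α<y ⊠⁺ (<-≤-trans 0<y (by-gap α (drop α (fromℕ 8 * D * x)) 0≤α))
      ⊠⁺ (positive⁻¹ (fromℕ 75) ⊠⁺ (0<E ⊠⁺ 0<E) ⊠⁺ 0<x))
    (by-gap _ (split α N c D E x)
      (0≤fromℕ 75 ⊠ 0≤E² ⊠ gap h₁ ⊞ (0≤c ⊠ 0≤c) ⊠ 0≤E² ⊠ gap h₂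
       ⊞ gap 1≤cE ⊠ (0≤c ⊠ 0≤E ⊞ 0≤1) ⊠ (0≤x ⊠ 0≤x ⊠ 0≤x ⊠ 0≤x)
       ⊞ 0≤x ⊠ 0≤x ⊠ 0≤x ⊠ gap h₃)))
  where
  0≤E : 0ℚ ≤ E
  0≤E = <⇒≤ 0<E
  0≤E² : 0ℚ ≤ E * E
  0≤E² = 0≤E ⊠ 0≤E
  0≤x : 0ℚ ≤ x
  0≤x = <⇒≤ 0<x
  0<y : 0ℚ < fromℕ 8 * D * x
  0<y = positive⁻¹ (fromℕ 8) ⊠⁺ 0<D ⊠⁺ 0<x
  0<gap : ∀ {p q} → p < q → 0ℚ < q - p
  0<gap {p} {q} p<q = subst (_< q - p) (+-inverseʳ p) (+-monoˡ-< (- p) p<q)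
  drop : ∀ α y → y + α - y ≡ α
  drop = solve-∀ ℚ-ring
  split : ∀ α N c D E x →
    0ℚ - (fromℕ 8 * D * x - α) * (fromℕ 8 * D * x + α) * (fromℕ 75 * (E * E) * x) ≡
    fromℕ 75 * (E * E) * (α * α * x - c * c * N) + c * c * (E * E) * (fromℕ 75 * N - x * x * x * x)
    + (c * E - 1ℚ) * (c * E + 1ℚ) * (x * x * x * x)
    + x * x * x * (x - fromℕ 4800 * (D * D) * (E * E))
  split = solve-∀ ℚ-ring

-- Choice of constants for large `n`.

small-eventual : ∀ {n a b k d} {ε : ℚ} .{{_ : NonZero a}} → 0ℚ < ε → 1ℚ ≤ ε * ⟦ suc d ⟧ →
  fromℕ k ≤ᵣ (+ 1 / (32 ℕ.* suc d)) ·ln n →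
  fromℕ 2 + fromℕ 128 * (⟦ suc d ⟧ * ⟦ suc d ⟧) ≤ H n → 8 ℕ.* suc d ℕ.≤ n →
  BiasBound ε n a b → MinDegStrategyWins n a b k
small-eventual {n} {a} {b} {k} {d} {ε} 0<ε 1≤εD k≤ big q≤n bias =
  small-wins k m C 1≤m m≤n (0≤fromℕ 16 ⊠ 0≤D ⊠ 0≤⟦ a ⟧) αβ≤mC λ h →
    small-absurd {x = H n} {H m} (0<⟦⟧ (ℕ.>-nonZero⁻¹ a)) (0<⟦⟧ (s≤s z≤n)) 0≤⟦ b ⟧ 0≤⟦ n ⟧ bias-D bias-N gap-≤ k-small m-small
      W-large W≤N (subst (α * N ≤_) unfold h)
  where
  open Game {n} a b using (α; β; γ; γ≡2β; small-wins)
  -- With `q = 8D` the cost `α * m` of the inner edges is at most an eighth of the gain `αN/D`.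
  q m : ℕ
  q = 8 ℕ.* suc d
  m = n ℕ./ q
  D N C : ℚ
  D = ⟦ suc d ⟧
  N = ⟦ n ⟧
  -- As `N ≤ 16Dm`, this reserve gives `αβ ≤ αN ≤ mC`.
  C = fromℕ 16 * D * α
  0≤D : 0ℚ ≤ D
  0≤D = 0≤⟦ suc d ⟧
  0≤ε : 0ℚ ≤ ε
  0≤ε = <⇒≤ 0<ε
  1≤m : 1 ℕ.≤ m
  1≤m = ℕ.m≥n⇒m/n>0 q≤n
  m≤n : m ℕ.≤ n
  m≤n = ℕ.m/n≤m n q
  1≤n : 1 ℕ.≤ n
  1≤n = ℕ.≤-trans 1≤m m≤n
  unfold : γ * ⟦ k ⟧ + α * β + α * ⟦ k ⟧ + (β * (H m - H 1) + α * (⟦ m ⟧ - ⟦ 1 ⟧) + (γ * (H n - H m) + C))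
    ≡ (β + β) * ⟦ k ⟧ + α * β + α * ⟦ k ⟧ + (β * (H m - 1ℚ) + α * (⟦ m ⟧ - 1ℚ) + ((β + β) * (H n - H m) + C))
  unfold = trans
    (cong (λ g → g * ⟦ k ⟧ + α * β + α * ⟦ k ⟧ + (β * (H m - H 1) + α * (⟦ m ⟧ - ⟦ 1 ⟧) + (g * (H n - H m) + C))) γ≡2β)
    (cong₂ (λ y z → (β + β) * ⟦ k ⟧ + α * β + α * ⟦ k ⟧
                      + (β * (H m - y) + α * (⟦ m ⟧ - z) + ((β + β) * (H n - H m) + C))) H-one ⟦1⟧)
  bias₀ : β * (H n - 1ℚ) ≤ (1ℚ - ε) * (α * N) - β * α
  bias₀ = resp-≤
    (cong₂ _*_ (⟦⟧≡fromℕ b) (sym (trans (lnLower-H n 1≤n) (cong (λ y → H n - y) H-one))))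
    (trans (cong₂ (λ x y → (1ℚ - ε) * (x * N) - y * x) (⟦⟧≡fromℕ a) (⟦⟧≡fromℕ b))
           (cong (λ z → (1ℚ - ε) * (fromℕ a * z) - fromℕ b * fromℕ a) (⟦⟧≡fromℕ n)))
    (bias 0)
  bias-D : D * (β * (H n - 1ℚ) + α * β) ≤ (D - 1ℚ) * (α * N)
  bias-D = by-gap _ (split ε D α β N (H n))
    (0≤D ⊠ gap bias₀ ⊞ gap 1≤εD ⊠ (0≤⟦ a ⟧ ⊠ 0≤⟦ n ⟧))
    where
    split : ∀ ε D α β N x → (D - 1ℚ) * (α * N) - D * (β * (x - 1ℚ) + α * β) ≡
      D * ((1ℚ - ε) * (α * N) - β * α - β * (x - 1ℚ)) + (ε * D - 1ℚ) * (α * N)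
    split = solve-∀ ℚ-ring
  bias-N : β * (H n - 1ℚ) ≤ α * N
  bias-N = by-gap _ (split ε α β N (H n))
    (gap bias₀ ⊞ 0≤ε ⊠ (0≤⟦ a ⟧ ⊠ 0≤⟦ n ⟧) ⊞ 0≤⟦ b ⟧ ⊠ 0≤⟦ a ⟧)
    where
    split : ∀ ε α β N x → α * N - β * (x - 1ℚ) ≡
      ((1ℚ - ε) * (α * N) - β * α - β * (x - 1ℚ)) + ε * (α * N) + β * α
    split = solve-∀ ℚ-ring
  1≤H : 1ℚ ≤ H n
  1≤H = subst (_≤ H n) H-one (H-mono 1≤n)
  αβ≤αN : α * β ≤ α * N
  αβ≤αN = by-gap _ (split ε α β N (H n))
    (gap bias₀ ⊞ 0≤ε ⊠ (0≤⟦ a ⟧ ⊠ 0≤⟦ n ⟧) ⊞ 0≤⟦ b ⟧ ⊠ gap 1≤H)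
    where
    split : ∀ ε α β N x → α * N - α * β ≡
      ((1ℚ - ε) * (α * N) - β * α - β * (x - 1ℚ)) + ε * (α * N) + β * (x - 1ℚ)
    split = solve-∀ ℚ-ring
  N≤16DM : N ≤ fromℕ 16 * D * ⟦ m ⟧
  N≤16DM = resp-≤ refl
    (sym (trans (⟦⟧-* (16 ℕ.* suc d) m) (cong (_* ⟦ m ⟧) (⟦⟧-numeral-* 16 (suc d)))))
    (⟦⟧-mono-≤ n≤)
    where
    double : ∀ d m → m ℕ.* (8 ℕ.* d) ℕ.+ m ℕ.* (8 ℕ.* d) ≡ 16 ℕ.* d ℕ.* m
    double = solve-∀ ℕ.ring
    -- The remainder is below `q`, and `q ≤ m * q` because `m` is at least 1; hence `n ≤ 2mq`.
    n≤ : n ℕ.≤ 16 ℕ.* suc d ℕ.* m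
    n≤ = ℕ.≤-trans (ℕ.≤-reflexive (ℕ.m≡m%n+[m/n]*n n q)) (ℕ.≤-trans
      (ℕ.+-monoˡ-≤ (m ℕ.* q) (ℕ.≤-trans (ℕ.<⇒≤ (ℕ.m%n<n n q))
        (ℕ.≤-trans (ℕ.≤-reflexive (sym (ℕ.*-identityˡ q))) (ℕ.*-monoˡ-≤ q 1≤m))))
      (ℕ.≤-reflexive (double (suc d) m)))
  αβ≤mC : α * β ≤ ⟦ m ⟧ * C
  αβ≤mC = ≤-trans αβ≤αN (subst (α * N ≤_) (reorder α D ⟦ m ⟧)
    (*-monoˡ-≤-nonNeg α {{nonNegative 0≤⟦ a ⟧}} N≤16DM))
    where
    reorder : ∀ α D M → α * (fromℕ 16 * D * M) ≡ M * (fromℕ 16 * D * α)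
    reorder = solve-∀ ℚ-ring
  m-small : fromℕ 8 * D * ⟦ m ⟧ ≤ N
  m-small = resp-≤ (sym (trans (⟦⟧-* q m) (cong (_* ⟦ m ⟧) (⟦⟧-numeral-* 8 (suc d))))) refl
    (⟦⟧-mono-≤ (ℕ.≤-trans (ℕ.≤-reflexive (ℕ.*-comm q m)) (ℕ.m/n*n≤m n q)))
  gap-≤ : H n - H m ≤ fromℕ 16 * D
  gap-≤ = *-cancelˡ-≤-pos ⟦ m ⟧ {{positive (0<⟦⟧ 1≤m)}} (≤-trans
    (subst (λ l → ⟦ m ⟧ * (H l - H m) ≤ ⟦ n ℕ.∸ m ⟧) (ℕ.m+[n∸m]≡n m≤n) (H-gap-≤ m (n ℕ.∸ m)))
    (≤-trans (⟦⟧-mono-≤ (ℕ.m∸n≤m n m)) (subst (N ≤_) (*-comm (fromℕ 16 * D) ⟦ m ⟧) N≤16DM)))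
  W-large : fromℕ 128 * (D * D) ≤ H n - 1ℚ
  W-large = by-gap _ (split (D * D) (H n)) (gap big ⊞ 0≤1)
    where
    split : ∀ D² x → x - 1ℚ - fromℕ 128 * D² ≡ (x - (fromℕ 2 + fromℕ 128 * D²)) + 1ℚ
    split = solve-∀ ℚ-ring
  W≤N : H n - 1ℚ ≤ N
  W≤N = by-gap _ (split N (H n)) (gap (H≤ n) ⊞ 0≤1)
    where
    split : ∀ N x → N - (x - 1ℚ) ≡ (N - x) + 1ℚ
    split = solve-∀ ℚ-ring
  -- The constant 32 gives `16Dk ≤ H n / 2`, and `H n / 2 ≤ H n − 1` because `H n ≥ 2`.
  k-small : fromℕ 16 * D * ⟦ k ⟧ ≤ H n - 1ℚ
  k-small = by-gap _ (split D ⟦ k ⟧ (H n))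
    (nonNegative⁻¹ ½ ⊠ (gap (subst (λ z → z * ⟦ k ⟧ ≤ H n) (⟦⟧-numeral-* 32 (suc d)) (o-ln-bound (32 ℕ.* suc d) {k} {n} k≤))
      ⊞ gap big ⊞ 0≤fromℕ 128 ⊠ (0≤D ⊠ 0≤D)))
    where
    split : ∀ D k x → x - 1ℚ - fromℕ 16 * D * k ≡
      ½ * ((x - fromℕ 32 * D * k) + (x - (fromℕ 2 + fromℕ 128 * (D * D))) + fromℕ 128 * (D * D))
    split = solve-∀ ℚ-ring

-- Here `a` dominates `H n`, so the loss (2b/a) `H n` is small against `n` and averaging over large
-- sets suffices.
large-eventual : ∀ {n a b k d e} {ε c : ℚ} .{{_ : NonZero a}} → 0ℚ < ε → 1ℚ ≤ ε * ⟦ suc d ⟧ →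
  0ℚ < c → 1ℚ ≤ c * ⟦ suc e ⟧ →
  (c * c * fromℕ n) ≤ᵣ (fromℕ a * fromℕ a) ·ln n →
  fromℕ k ≤ (+ 1 / (8 ℕ.* suc d)) * fromℕ a → fromℕ k ≤ (+ 1 / (8 ℕ.* suc d)) * fromℕ n →
  fromℕ 4800 * (⟦ suc d ⟧ * ⟦ suc d ⟧) * (⟦ suc e ⟧ * ⟦ suc e ⟧) ≤ H n → 1 ℕ.≤ n →
  fromℕ b ≤ (1ℚ - ε) * fromℕ n → MinDegStrategyWins n a b k
large-eventual {n} {a} {b} {k} {d} {e} {ε} {c} 0<ε 1≤εD 0<c 1≤cE a-large k≤a k≤n big 1≤n bias =
  large-wins k 1≤n λ h →
    large-absurd (0<⟦⟧ (ℕ.>-nonZero⁻¹ a)) (0<⟦⟧ 1≤n) 0≤⟦ b ⟧ 0≤D (0≤H 1) bias-D bias-N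
      (k-bound k≤n) (k-bound k≤a) H-small
      (subst (α * N ≤_) (cong (λ g → g * ⟦ k ⟧ + α * β + α * ⟦ k ⟧ + g * (H n - H 1)) γ≡2β) h)
  where
  open Game {n} a b using (α; β; γ; γ≡2β; large-wins)
  D N : ℚ
  D = ⟦ suc d ⟧
  N = ⟦ n ⟧
  0≤D : 0ℚ ≤ D
  0≤D = 0≤⟦ suc d ⟧
  bias₀ : β ≤ (1ℚ - ε) * N
  bias₀ = resp-≤ (⟦⟧≡fromℕ b) (cong ((1ℚ - ε) *_) (⟦⟧≡fromℕ n)) bias
  bias-D : D * β ≤ (D - 1ℚ) * N
  bias-D = by-gap _ (split ε D β N) (0≤D ⊠ gap bias₀ ⊞ gap 1≤εD ⊠ 0≤⟦ n ⟧)
    where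
    split : ∀ ε D β N → (D - 1ℚ) * N - D * β ≡ D * ((1ℚ - ε) * N - β) + (ε * D - 1ℚ) * N
    split = solve-∀ ℚ-ring
  bias-N : β ≤ N
  bias-N = by-gap _ (split ε β N) (gap bias₀ ⊞ <⇒≤ 0<ε ⊠ 0≤⟦ n ⟧)
    where
    split : ∀ ε β N → N - β ≡ ((1ℚ - ε) * N - β) + ε * N
    split = solve-∀ ℚ-ring
  k-bound : ∀ {m} → fromℕ k ≤ (+ 1 / (8 ℕ.* suc d)) * fromℕ m → fromℕ 8 * D * ⟦ k ⟧ ≤ ⟦ m ⟧
  k-bound {m} p = subst (λ z → z * ⟦ k ⟧ ≤ ⟦ m ⟧) (⟦⟧-numeral-* 8 (suc d)) (o-bound (8 ℕ.* suc d) {k} {m} p)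
  a-large₀ : c * c * N ≤ α * α * H n
  a-large₀ = ≤-trans
    (resp-≤ (cong (c * c *_) (⟦⟧≡fromℕ n))
      (cong₂ (λ x y → x * x * y) (⟦⟧≡fromℕ a) (sym (lnUpper-H n))) (a-large 0))
    (*-monoˡ-≤-nonNeg (α * α) {{nonNegative (0≤⟦ a ⟧ ⊠ 0≤⟦ a ⟧)}} (H∸1≤H n))
  H-small : fromℕ 8 * D * H n ≤ α
  H-small = H≪a {c = c} 0≤⟦ a ⟧ (0<⟦⟧ (s≤s z≤n)) (0<⟦⟧ {suc e} (s≤s z≤n))
    (<-≤-trans (positive⁻¹ 1ℚ) (subst (_≤ H n) H-one (H-mono 1≤n))) 1≤cE (<⇒≤ 0<c)
    a-large₀ (proj₂ (proj₂ (H-powers n))) big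

theorem7 : (∀ (ε : ℚ) → 0ℚ < ε →
    ∀ (k a : ℕ → ℕ) .{{_ : ∀ {n} → NonZero (a n)}} →
    k ∈o-ln →
    a ∈o-√[n/ln] →
    Eventually λ n →
    ∀ (b : ℕ) .{{_ : NonZero b}} →
    BiasBound ε n (a n) b →
    MinDegStrategyWins n (a n) b (k n))
    ×
    (∀ (ε : ℚ) → 0ℚ < ε →
    ∀ (k a : ℕ → ℕ) .{{_ : ∀ {n} → NonZero (a n)}} →
    a ∈Ω-√[n/ln] →
    k ∈o a →
    k ∈o id →
    Eventually λ n →
    ∀ (b : ℕ) .{{_ : NonZero b}} →
    fromℕ b ≤ (1ℚ - ε) * fromℕ n →
    MinDegStrategyWins n (a n) b (k n))
theorem7 = part-i , part-ii
  where
  0<recip : ∀ c .{{_ : NonZero c}} → 0ℚ < + 1 / c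
  0<recip c = positive⁻¹ (+ 1 / c) {{normalize-pos 1 c}}
  part-i : ∀ (ε : ℚ) → 0ℚ < ε →
    ∀ (k a : ℕ → ℕ) .{{_ : ∀ {n} → NonZero (a n)}} → k ∈o-ln → a ∈o-√[n/ln] →
    Eventually λ n → ∀ (b : ℕ) .{{_ : NonZero b}} → BiasBound ε n (a n) b →
    MinDegStrategyWins n (a n) b (k n)
  part-i ε 0<ε k a k-small _ =
    let N , from-N = eventually-∧ (k-small (+ 1 / (32 ℕ.* suc d)) (0<recip (32 ℕ.* suc d)))
          (eventually-∧ (H-unbounded (fromℕ 2 + fromℕ 128 * (⟦ suc d ⟧ * ⟦ suc d ⟧)))
            -- This threshold makes `n / (8D)` at least 1, so that singletons fall within the range
            -- of the small-set bound.
            (8 ℕ.* suc d , λ _ q≤n → q≤n))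
    in N , λ n N≤n b bias → let k≤ , big , q≤n = from-N n N≤n in
      small-eventual {n} {a n} {b} {k n} {d} 0<ε (proj₂ (scale ε 0<ε)) k≤ big q≤n bias
    where
    d : ℕ
    d = proj₁ (scale ε 0<ε)
  part-ii : ∀ (ε : ℚ) → 0ℚ < ε →
    ∀ (k a : ℕ → ℕ) .{{_ : ∀ {n} → NonZero (a n)}} → a ∈Ω-√[n/ln] → k ∈o a → k ∈o id →
    Eventually λ n → ∀ (b : ℕ) .{{_ : NonZero b}} → fromℕ b ≤ (1ℚ - ε) * fromℕ n →
    MinDegStrategyWins n (a n) b (k n)
  part-ii ε 0<ε k a (c , 0<c , a-large) k≪a k≪n =
    let N , from-N = eventually-∧ a-large
          (eventually-∧ (k≪a (+ 1 / (8 ℕ.* suc d)) (0<recip (8 ℕ.* suc d)))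
          (eventually-∧ (k≪n (+ 1 / (8 ℕ.* suc d)) (0<recip (8 ℕ.* suc d)))
          (eventually-∧ (H-unbounded (fromℕ 4800 * (⟦ suc d ⟧ * ⟦ suc d ⟧) * (⟦ suc e ⟧ * ⟦ suc e ⟧)))
            (1 , λ _ 1≤n → 1≤n))))
    in N , λ n N≤n b bias → let a≥ , k≤a , k≤n , big , 1≤n = from-N n N≤n in
      large-eventual {n} {a n} {b} {k n} {d} {e} 0<ε (proj₂ (scale ε 0<ε)) 0<c (proj₂ (scale c 0<c))
        a≥ k≤a k≤n big 1≤n bias
    where
    d e : ℕ
    d = proj₁ (scale ε 0<ε)
    e = proj₁ (scale c 0<c)
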